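{- Let $F_k$ be a non-abelian free group. Then the elementary theory of $F_k$ is not equational: there exists a definable set $D(p,q)$ in $F_k$ which is not in the Boolean algebra generated by equational sets (for the same partition of the variables into $p$ and $q$).
   Context: Equationality is in the sense of G. Srour. For a structure $M$ and a definable set $D(p,q)\subseteq M^{|p|}\times M^{|q|}$ (with the variables partitioned into a tuple $p$ and a tuple $q$), write $D(p,q_0)=\{p_0 : (p_0,q_0)\in D\}$. The set $D(p,q)$ is called equational if there is a constant $N_D$ such that for every finite sequence of values $q_1,\dots,q_m$ for which the sequence of intersections $\big\{\bigcap_{i=1}^{j} D(p,q_i)\big\}_{j=1}^{m}$ is strictly decreasing, one has $m\le N_D$. A theory is equational if every definable set $D(p,q)$ (for every partition of its variables) is a Boolean combination of equational sets $E(p,q)$ with the same partition of variables. A set is co-equational if it is the complement of an equational set. -}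

module Defs where

open import Data.Nat using (ℕ; zero; suc; _+_; _≤_; _<_)
open import Data.Fin using (Fin; toℕ) renaming (_≟_ to _≟F_)
open import Data.Bool using (Bool; true; false; not) renaming (_≟_ to _≟B_)
open import Data.Product using (Σ; _×_; _,_)
open import Data.Product.Properties using (≡-dec)
open import Data.List using (List; []; _∷_; _++_; reverse; map; foldr)
open import Data.Vec.Functional as V using (Vector)
open import Relation.Nullary using (¬_; does)
open import Relation.Binary.PropositionalEquality using (_≡_)
open import Data.Unit using (⊤)
open import Data.Empty using (⊥)

-- A letter is a generator x_i (true) or its inverse x_i⁻¹ (false).
Letter : ℕ → Set
Letter k = Fin k × Bool

invL : ∀ {k} → Letter k → Letter k
invL (i , b) = (i , not b)

Word : ℕ → Set
Word k = List (Letter k)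

push : ∀ {k} → Letter k → Word k → Word k
push x [] = x ∷ []
push x (y ∷ ys) with does (≡-dec _≟F_ _≟B_ x (invL y))
... | true  = ys
... | false = x ∷ y ∷ ys

reduce : ∀ {k} → Word k → Word k
reduce = foldr push []

wone : ∀ {k} → Word k
wone = []

wmul : ∀ {k} → Word k → Word k → Word k
wmul u v = u ++ v

winv : ∀ {k} → Word k → Word k
winv u = reverse (map invL u)

_≈F_ : ∀ {k} → Word k → Word k → Set
u ≈F v = reduce u ≡ reduce v

data Term (v : ℕ) : Set where
  var  : Fin v → Term v
  one  : Term v
  _·_  : Term v → Term v → Term v
  _⁻¹  : Term v → Term v

data Formula : ℕ → Set where
  _≐_  : ∀ {v} → Term v → Term v → Formula v
  tt ff : ∀ {v} → Formula v
  ¬'_  : ∀ {v} → Formula v → Formula v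
  _∧'_ _∨'_ _⇒'_ : ∀ {v} → Formula v → Formula v → Formula v
  ∀'_ ∃'_ : ∀ {v} → Formula (suc v) → Formula v

Assignment : ℕ → ℕ → Set
Assignment k v = Vector (Word k) v

eval : ∀ {k v} → Assignment k v → Term v → Word k
eval ρ (var i) = ρ i
eval ρ one     = wone
eval ρ (t · s) = wmul (eval ρ t) (eval ρ s)
eval ρ (t ⁻¹)  = winv (eval ρ t)

-- Satisfaction in F_k.  Classical (Gödel–Gentzen) reading of ∨ and ∃,
-- so that truth agrees with classical first-order truth.
Sat : ∀ k {v} → Formula v → Assignment k v → Set
Sat k (t ≐ s)  ρ = eval ρ t ≈F eval ρ s
Sat k tt       ρ = ⊤
Sat k ff       ρ = ⊥
Sat k (¬' φ)   ρ = ¬ Sat k φ ρ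
Sat k (φ ∧' ψ) ρ = Sat k φ ρ × Sat k ψ ρ
Sat k (φ ∨' ψ) ρ = ¬ (¬ Sat k φ ρ × ¬ Sat k ψ ρ)
Sat k (φ ⇒' ψ) ρ = Sat k φ ρ → Sat k ψ ρ
Sat k (∀' φ)   ρ = (w : Word k) → Sat k φ (w V.∷ ρ)
Sat k (∃' φ)   ρ = ¬ ((w : Word k) → ¬ Sat k φ (w V.∷ ρ))

Rel : ℕ → ℕ → ℕ → Set₁
Rel k n m = Assignment k n → Assignment k m → Set

⟦_⟧ : ∀ {k n m} → Formula (n + m) → Rel k n m
⟦_⟧ {k} φ p q = Sat k φ (p V.++ q)

-- p ∈ ⋂_{i=1}^{j} D(p, q_i)   (indices shifted to start at 0)
Inter : ∀ {k n m} → Rel k n m → (l : ℕ) → (Fin l → Assignment k m) →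
        ℕ → Assignment k n → Set
Inter D l qs j p = (i : Fin l) → toℕ i < j → D p (qs i)

StrictlyDecreasing : ∀ {k n m} → Rel k n m → (l : ℕ) →
                     (Fin l → Assignment k m) → Set
StrictlyDecreasing {k} {n} D l qs =
  (j : ℕ) → 1 ≤ j → suc j ≤ l →
  ¬ ((p : Assignment k n) → Inter D l qs j p → Inter D l qs (suc j) p)

Equational : ∀ {k n m} → Rel k n m → Set
Equational {k} {n} {m} D =
  Σ ℕ λ N → (l : ℕ) (qs : Fin l → Assignment k m) →
    StrictlyDecreasing D l qs → l ≤ N

data InBA {k n m : ℕ} : Rel k n m → Set₁ where
  gen   : (ψ : Formula (n + m)) → Equational {k} {n} {m} ⟦ ψ ⟧ →
          InBA ⟦ ψ ⟧
  top   : InBA (λ p q → ⊤)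
  compl : ∀ {A} → InBA A → InBA (λ p q → ¬ A p q)
  inter : ∀ {A B} → InBA A → InBA B → InBA (λ p q → A p q × B p q)
  union : ∀ {A B} → InBA A → InBA B →
          InBA (λ p q → ¬ (¬ A p q × ¬ B p q))

{-# OPTIONS --safe #-}

-- Definable sets are invariant under conjugation, so on the pairs (X^g , X^h), X a pair of basis
-- elements, a definable set is given by a set E of group elements g⁻¹h. If it is equational, then
-- in a long sequence of pairs (a , b) such that a' b ∈ E whenever (a , b) precedes (a' , b'), some
-- a b is in E; by Ramsey's theorem finite unions of such sets E have the same property.
--
-- Let D be the set of all u^(n+1) v^(-n) with u and v not commuting, and let c be outside E₁, …, Eᵣ.
-- For pairs (a , a⁻¹ c) the products a a⁻¹ c are all c, so some a' a⁻¹ c is outside E₁, …, Eᵣ; the a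
-- can be chosen such that none of these elements is in D. Taking a sequence of elements t obtained
-- in this way, t = t^(n+1) t^(-n) shows that some t'^(n+1) t^(-n), an element of D, is outside
-- E₁, …, Eᵣ. If c is outside as many as possible of finitely many given equational sets, then t and
-- t'^(n+1) t^(-n) lie in the same ones, so D is not a Boolean combination of them.
--
-- The elements a' a⁻¹ c contain many subwords that occur only once in their cyclic conjugates. If
-- such an element is conjugate to u^m v^(-n), then either u^m and v^n have a long common part, and u
-- and v commute by the theorem of Fine and Wilf, or some cyclic conjugate is composed of boundedly
-- many pieces whose subwords all occur twice.

module Submission where

open import Defs
open import Data.Bool using (Bool; true; false; not) renaming (_≟_ to _≟B_)
open import Data.Bool.Properties using (not-involutive)
open import Data.Empty using (⊥; ⊥-elim)
open import Data.Fin using (Fin; zero; suc; toℕ; fromℕ<) renaming (_≟_ to _≟F_)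
open import Data.Fin.Properties using (toℕ-fromℕ<)
open import Data.List using (List; []; _∷_; _++_; reverse; map; foldr; length; head; last; concat; replicate; lookup; applyUpTo; initLast; _∷ʳ′_)
open import Data.List.Properties hiding (≡-dec)
open import Data.List.Membership.Propositional.Properties using (∈-lookup)
open import Data.List.Relation.Binary.Sublist.Propositional using (_⊆_; []; _∷_; _∷ʳ_; ⊆-trans; minimum)
open import Data.List.Relation.Binary.Sublist.Propositional.Properties using (All-resp-⊆)
open import Data.List.Relation.Unary.All as All using (All; []; _∷_)
import Data.List.Relation.Unary.All.Properties as All
open import Data.List.Relation.Unary.AllPairs as AllPairs using (AllPairs; []; _∷_)
import Data.List.Relation.Unary.AllPairs.Properties as AllPairs
open import Data.List.Relation.Unary.Any using (Any; here; there)
open import Data.List.Relation.Unary.Linked using (Linked; []; [-]; _∷_)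
open import Data.Maybe as Maybe using (Maybe; just; nothing)
open import Data.Maybe.Properties using (just-injective)
open import Data.Nat using (ℕ; zero; suc; _+_; _*_; _≤_; _<_; z≤n; s≤s; NonZero; _≤?_) renaming (_≟_ to _≟ℕ_)
open import Data.Nat.Properties hiding (_≟_; _≤?_)
open import Data.Product using (Σ; ∃; ∃₂; _×_; _,_; proj₁; proj₂; swap)
open import Data.Product.Properties using (≡-dec)
open import Data.Sum using (_⊎_; inj₁; inj₂; [_,_]′)
open import Data.Vec.Functional as V using ()
open import Function using (_∘_; id)
open import Relation.Binary.PropositionalEquality
open import Relation.Nullary using (¬_; Dec; yes; no)

variable
  k : ℕ

_≟L_ : (a b : Letter k) → Dec (a ≡ b)
_≟L_ = ≡-dec _≟F_ _≟B_

invL-invol : (a : Letter k) → invL (invL a) ≡ a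
invL-invol (i , b) = cong (i ,_) (not-involutive b)

invL-injective : {a b : Letter k} → invL a ≡ invL b → a ≡ b
invL-injective {a = a} {b} e = trans (sym (invL-invol a)) (trans (cong invL e) (invL-invol b))

a≢invLa : (a : Letter k) → a ≢ invL a
a≢invLa (i , true) ()
a≢invLa (i , false) ()

-- Free reduction

Red : Word k → Set
Red = Linked (λ a b → a ≢ invL b)

-- No cancellation at the junction of u and v.
NC : Word k → Word k → Set
NC u v = ∀ {a b} → last u ≡ just a → head v ≡ just b → a ≢ invL b

push-cancel : (a : Letter k) (w : Word k) → push (invL a) (a ∷ w) ≡ w
push-cancel a w with invL a ≟L invL a
... | yes _ = refl
... | no ¬p = ⊥-elim (¬p refl)

push-cons : {a b : Letter k} (w : Word k) → a ≢ invL b → push a (b ∷ w) ≡ a ∷ b ∷ w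
push-cons {a = a} {b} w a≢ with a ≟L invL b
... | yes p = ⊥-elim (a≢ p)
... | no _ = refl

red-tail : {a : Letter k} {w : Word k} → Red (a ∷ w) → Red w
red-tail [-] = []
red-tail (_ ∷ r) = r

red-push : (a : Letter k) {w : Word k} → Red w → Red (push a w)
red-push a {[]} r = [-]
red-push a {b ∷ w} r with a ≟L invL b
... | yes p = red-tail r
... | no ¬p = ¬p ∷ r

red-act : (u : Word k) {w : Word k} → Red w → Red (foldr push w u)
red-act [] r = r
red-act (a ∷ u) r = red-push a (red-act u r)

red-reduce : (u : Word k) → Red (reduce u)
red-reduce u = red-act u []

reduce-red : {w : Word k} → Red w → reduce w ≡ w
reduce-red [] = refl
reduce-red [-] = refl
reduce-red {w = a ∷ b ∷ w} (p ∷ r) = trans (cong (push a) (reduce-red r)) (push-cons w p)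

-- On reduced words a letter and its inverse act by mutually inverse maps. This is what makes `push`
-- an action of the free group on reduced words, as in van der Waerden's construction.
push-push : (a : Letter k) {w : Word k} → Red w → push (invL a) (push a w) ≡ w
push-push a {[]} r = push-cancel a []
push-push a {b ∷ w} r with a ≟L invL b
push-push a {b ∷ w} r | no ¬p = push-cancel a (b ∷ w)
push-push a {b ∷ []} r | yes refl = cong (_∷ []) (invL-invol b)
push-push a {b ∷ c ∷ w} (p ∷ r) | yes refl =
  trans (cong (λ x → push x (c ∷ w)) (invL-invol b)) (push-cons w p)

act-push : (a : Letter k) {u : Word k} {w : Word k} → Red w →
  foldr push w (push a u) ≡ push a (foldr push w u)
act-push a {[]} r = refl
act-push a {b ∷ u} {w} r with a ≟L invL b
... | no ¬p = refl
... | yes refl = sym (push-push b (red-act u r))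

-- Every cancellation made during reduction is trivial in the action, by `push-push`. Reduction is
-- therefore compatible with concatenation, which gives `++-cong-≈`.
act-reduce : (u : Word k) {w : Word k} → Red w → foldr push w (reduce u) ≡ foldr push w u
act-reduce [] r = refl
act-reduce (a ∷ u) r = trans (act-push a {reduce u} r) (cong (push a) (act-reduce u r))

length-push : (a : Letter k) (w : Word k) → length (push a w) ≤ suc (length w)
length-push a [] = ≤-refl
length-push a (b ∷ w) with a ≟L invL b
... | yes _ = m≤n⇒m≤1+n (m≤n⇒m≤1+n ≤-refl)
... | no _ = ≤-refl

length-reduce : (u : Word k) → length (reduce u) ≤ length u
length-reduce [] = z≤n
length-reduce (a ∷ u) = ≤-trans (length-push a (reduce u)) (s≤s (length-reduce u))

-- The relation ≈F as a record, so that its two sides can be inferred.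
record _≈_ {k} (u v : Word k) : Set where
  constructor eq
  field un : u ≈F v
open _≈_ public

infix 4 _≈_

≈-refl : {u : Word k} → u ≈ u
≈-refl = eq refl

≈-sym : {u v : Word k} → u ≈ v → v ≈ u
≈-sym (eq p) = eq (sym p)

≈-trans : {u v w : Word k} → u ≈ v → v ≈ w → u ≈ w
≈-trans (eq p) (eq q) = eq (trans p q)

≡⇒≈ : {u v : Word k} → u ≡ v → u ≈ v
≡⇒≈ refl = ≈-refl

reduce-≈ : (u : Word k) → reduce u ≈ u
reduce-≈ u = eq (reduce-red (red-reduce u))

red-unique : {u v : Word k} → Red u → Red v → u ≈ v → u ≡ v
red-unique r s (eq p) = trans (sym (reduce-red r)) (trans p (reduce-red s))

++-cong-≈ : {u u′ v v′ : Word k} → u ≈ u′ → v ≈ v′ → u ++ v ≈ u′ ++ v′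
++-cong-≈ {u = u} {u′} {v} {v′} (eq p) (eq q) = eq (begin
  reduce (u ++ v)                  ≡⟨ foldr-++ push [] u v ⟩
  foldr push (reduce v) u          ≡⟨ act-reduce u (red-reduce v) ⟨
  foldr push (reduce v) (reduce u) ≡⟨ cong₂ (foldr push) q p ⟩
  foldr push (reduce v′) (reduce u′) ≡⟨ act-reduce u′ (red-reduce v′) ⟩
  foldr push (reduce v′) u′        ≡⟨ foldr-++ push [] u′ v′ ⟨
  reduce (u′ ++ v′)                ∎)
  where open ≡-Reasoning

winv-∷ : (a : Letter k) (w : Word k) → winv (a ∷ w) ≡ winv w ++ invL a ∷ []
winv-∷ a w = unfold-reverse (invL a) (map invL w)

winv-++ : (u v : Word k) → winv (u ++ v) ≡ winv v ++ winv u
winv-++ u v = trans (cong reverse (map-++ invL u v)) (reverse-++ (map invL u) (map invL v))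

winv-invol : (u : Word k) → winv (winv u) ≡ u
winv-invol [] = refl
winv-invol (a ∷ u) = begin
  winv (winv (a ∷ u)) ≡⟨ cong winv (winv-∷ a u) ⟩
  winv (winv u ++ invL a ∷ []) ≡⟨ winv-++ (winv u) (invL a ∷ []) ⟩
  invL (invL a) ∷ winv (winv u) ≡⟨ cong₂ _∷_ (invL-invol a) (winv-invol u) ⟩
  a ∷ u ∎
  where open ≡-Reasoning

length-winv : (u : Word k) → length (winv u) ≡ length u
length-winv u = trans (length-reverse (map invL u)) (length-map invL u)

winv-inverseˡ : (u : Word k) → winv u ++ u ≈ []
winv-inverseˡ [] = ≈-refl
winv-inverseˡ (a ∷ u) = ≈-trans (≡⇒≈ (trans (cong (_++ a ∷ u) (winv-∷ a u)) (++-assoc (winv u) _ _)))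
  (≈-trans (++-cong-≈ (≈-refl {u = winv u}) (eq {u = invL a ∷ a ∷ u} {v = u} (push-push a (red-reduce u))))
      (winv-inverseˡ u))

winv-inverseʳ : (u : Word k) → u ++ winv u ≈ []
winv-inverseʳ u = ≈-trans (≡⇒≈ (cong (_++ winv u) (sym (winv-invol u)))) (winv-inverseˡ (winv u))

winv-cong-≈ : {u v : Word k} → u ≈ v → winv u ≈ winv v
winv-cong-≈ {u = u} {v} p =
  ≈-trans (≡⇒≈ (sym (++-identityʳ (winv u))))
  (≈-trans (++-cong-≈ (≈-refl {u = winv u}) (≈-sym (winv-inverseʳ v)))
  (≈-trans (≡⇒≈ (sym (++-assoc (winv u) v (winv v))))
  (++-cong-≈ (≈-trans (++-cong-≈ (≈-refl {u = winv u}) (≈-sym p)) (winv-inverseˡ u)) (≈-refl {u = winv v}))))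

-- An equation between group terms holds in all free groups as soon as it holds for
-- the generators of the free group on its variables, where it is decided by reduction.

evalʷ : {v : ℕ} → (Fin v → Word k) → Word v → Word k
evalʷ ρ [] = []
evalʷ ρ ((i , true) ∷ w) = ρ i ++ evalʷ ρ w
evalʷ ρ ((i , false) ∷ w) = winv (ρ i) ++ evalʷ ρ w

module _ {k v : ℕ} (ρ : Fin v → Word k) where

  evalʷ-++ : (u w : Word v) → evalʷ ρ (u ++ w) ≡ evalʷ ρ u ++ evalʷ ρ w
  evalʷ-++ [] w = refl
  evalʷ-++ ((i , true) ∷ u) w = trans (cong (ρ i ++_) (evalʷ-++ u w)) (sym (++-assoc (ρ i) _ _))
  evalʷ-++ ((i , false) ∷ u) w = trans (cong (winv (ρ i) ++_) (evalʷ-++ u w)) (sym (++-assoc (winv (ρ i)) _ _))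

  evalʷ-letter : (a : Letter v) (w : Word v) → evalʷ ρ (invL a ∷ a ∷ w) ≈ evalʷ ρ w
  evalʷ-letter (i , true) w = ≈-trans (≡⇒≈ (sym (++-assoc (winv (ρ i)) _ _)))
      (++-cong-≈ (winv-inverseˡ (ρ i)) ≈-refl)
  evalʷ-letter (i , false) w = ≈-trans (≡⇒≈ (sym (++-assoc (ρ i) _ _))) (++-cong-≈ (winv-inverseʳ (ρ i)) ≈-refl)

  evalʷ-∷ : (a : Letter v) (w : Word v) → evalʷ ρ (a ∷ w) ≡ evalʷ ρ (a ∷ []) ++ evalʷ ρ w
  evalʷ-∷ a w = evalʷ-++ (a ∷ []) w

  evalʷ-push : (a : Letter v) (w : Word v) → evalʷ ρ (push a w) ≈ evalʷ ρ (a ∷ w)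
  evalʷ-push a [] = ≈-refl
  evalʷ-push a (b ∷ w) with a ≟L invL b
  ... | no _ = ≈-refl
  ... | yes refl = ≈-sym (evalʷ-letter b w)

  evalʷ-reduce : (w : Word v) → evalʷ ρ (reduce w) ≈ evalʷ ρ w
  evalʷ-reduce [] = ≈-refl
  evalʷ-reduce (a ∷ w) = ≈-trans (evalʷ-push a (reduce w))
    (≈-trans (≡⇒≈ (evalʷ-∷ a (reduce w)))
    (≈-trans (++-cong-≈ (≈-refl {u = evalʷ ρ (a ∷ [])}) (evalʷ-reduce w)) (≡⇒≈ (sym (evalʷ-∷ a w)))))

  evalʷ-winv : (w : Word v) → evalʷ ρ (winv w) ≡ winv (evalʷ ρ w)
  evalʷ-winv [] = refl
  evalʷ-winv (a ∷ w) = begin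
    evalʷ ρ (winv (a ∷ w)) ≡⟨ cong (evalʷ ρ) (winv-∷ a w) ⟩
    evalʷ ρ (winv w ++ invL a ∷ []) ≡⟨ evalʷ-++ (winv w) _ ⟩
    evalʷ ρ (winv w) ++ evalʷ ρ (invL a ∷ []) ≡⟨ cong₂ _++_ (evalʷ-winv w) (lemma a) ⟩
    winv (evalʷ ρ w) ++ winv (evalʷ ρ (a ∷ [])) ≡⟨ winv-++ (evalʷ ρ (a ∷ [])) (evalʷ ρ w) ⟨
    winv (evalʷ ρ (a ∷ []) ++ evalʷ ρ w) ≡⟨ cong winv (evalʷ-∷ a w) ⟨
    winv (evalʷ ρ (a ∷ w)) ∎
    where
    open ≡-Reasoning
    lemma : (a : Letter v) → evalʷ ρ (invL a ∷ []) ≡ winv (evalʷ ρ (a ∷ []))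
    lemma (i , true) = trans (++-identityʳ (winv (ρ i))) (cong winv (sym (++-identityʳ (ρ i))))
    lemma (i , false) = trans (++-identityʳ (ρ i)) (trans (sym (winv-invol (ρ i)))
        (cong winv (sym (++-identityʳ (winv (ρ i))))))

  gens : Fin v → Word v
  gens i = (i , true) ∷ []

  eval-gens : (t : Term v) → evalʷ ρ (eval gens t) ≡ eval ρ t
  eval-gens (var i) = ++-identityʳ (ρ i)
  eval-gens one = refl
  eval-gens (t · s) = trans (evalʷ-++ (eval gens t) _) (cong₂ _++_ (eval-gens t) (eval-gens s))
  eval-gens (t ⁻¹) = trans (evalʷ-winv (eval gens t)) (cong winv (eval-gens t))

  group-identity : (t s : Term v) → eval gens t ≈F eval gens s → eval ρ t ≈ eval ρ s
  group-identity t s p = ≈-trans (≡⇒≈ (sym (eval-gens t))) (≈-trans (≈-sym (evalʷ-reduce (eval gens t)))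
    (≈-trans (≡⇒≈ (cong (evalʷ ρ) p)) (≈-trans (evalʷ-reduce (eval gens s)) (≡⇒≈ (eval-gens s)))))

pattern x₀ = var zero
pattern x₁ = var (suc zero)
pattern x₂ = var (suc (suc zero))
pattern x₃ = var (suc (suc (suc zero)))
pattern x₄ = var (suc (suc (suc (suc zero))))

-- Powers of words

module _ {A : Set} where

  split-++ : (p : List A) {s : List A} (q : List A) {t : List A} → p ++ s ≡ q ++ t → length p ≤ length q →
    ∃ λ r → q ≡ p ++ r × s ≡ r ++ t
  split-++ [] q e l = q , refl , e
  split-++ (a ∷ p) (b ∷ q) e (s≤s l) with ∷-injective e
  ... | refl , e′ with split-++ p q e′ l
  ... | r , e₁ , e₂ = r , cong (a ∷_) e₁ , e₂

  split-≡ : (p : List A) {s : List A} (q : List A) {t : List A} → p ++ s ≡ q ++ t → length p ≡ length q →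
    p ≡ q × s ≡ t
  split-≡ [] [] e l = refl , e
  split-≡ (a ∷ p) (b ∷ q) e l with ∷-injective e
  ... | refl , e′ with split-≡ p q e′ (suc-injective l)
  ... | e₁ , e₂ = cong (a ∷_) e₁ , e₂

  last-++ : (u : List A) {v : List A} → v ≢ [] → last (u ++ v) ≡ last v
  last-++ [] n = refl
  last-++ (a ∷ []) {[]} n = ⊥-elim (n refl)
  last-++ (a ∷ []) {b ∷ v} n = refl
  last-++ (a ∷ b ∷ u) n = last-++ (b ∷ u) n

  last-∷ʳ : (u : List A) (a : A) → last (u ++ a ∷ []) ≡ just a
  last-∷ʳ u a = last-++ u {a ∷ []} λ ()

  head-++ : (u : List A) {v : List A} → u ≢ [] → head (u ++ v) ≡ head u
  head-++ [] n = ⊥-elim (n refl)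
  head-++ (a ∷ u) n = refl

  ++-≢[]ʳ : (u : List A) {v : List A} → v ≢ [] → u ++ v ≢ []
  ++-≢[]ʳ [] n = n
  ++-≢[]ʳ (a ∷ u) n ()

  ++-≢[]ˡ : {u : List A} (v : List A) → u ≢ [] → u ++ v ≢ []
  ++-≢[]ˡ {[]} v n = ⊥-elim (n refl)
  ++-≢[]ˡ {a ∷ u} v n ()

  unsnoc : (a : A) (u : List A) → ∃₂ λ v b → a ∷ u ≡ v ++ b ∷ []
  unsnoc a [] = [] , a , refl
  unsnoc a (b ∷ u) with unsnoc b u
  ... | v , c , e = a ∷ v , c , cong (a ∷_) e

  Infix : List A → List A → Set
  Infix w z = ∃₂ λ ξ ζ → z ≡ ξ ++ w ++ ζ

  infix-refl : {w : List A} → Infix w w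
  infix-refl {w} = [] , [] , sym (++-identityʳ w)

  infix-++ˡ : (α : List A) {w z : List A} → Infix w z → Infix w (α ++ z)
  infix-++ˡ α {w} (ξ , ζ , refl) = α ++ ξ , ζ , sym (++-assoc α ξ _)

  infix-++ʳ : (β : List A) {w z : List A} → Infix w z → Infix w (z ++ β)
  infix-++ʳ β {w} (ξ , ζ , refl) = ξ , ζ ++ β , trans (++-assoc ξ _ β) (cong (ξ ++_) (++-assoc w ζ β))

  infix-trans : {u v w : List A} → Infix u v → Infix v w → Infix u w
  infix-trans i (ξ , ζ , refl) = infix-++ˡ ξ (infix-++ʳ ζ i)

  infix-length : {u v : List A} → Infix u v → length u ≤ length v
  infix-length {u} (ξ , ζ , refl) = ≤-trans (m≤m+n (length u) (length ζ))
      (≤-trans (≤-reflexive (sym (length-++ u)))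
    (≤-trans (m≤n+m _ (length ξ)) (≤-reflexive (sym (length-++ ξ)))))

  pow : List A → ℕ → List A
  pow u zero = []
  pow u (suc n) = u ++ pow u n

  pow-comm : (u : List A) (n : ℕ) → pow u n ++ u ≡ u ++ pow u n
  pow-comm u zero = sym (++-identityʳ u)
  pow-comm u (suc n) = trans (++-assoc u _ u) (cong (u ++_) (pow-comm u n))

  length-pow : (u : List A) (n : ℕ) → length (pow u n) ≡ n * length u
  length-pow u zero = refl
  length-pow u (suc n) = trans (length-++ u) (cong (length u +_) (length-pow u n))

  pow-concat : (u : List A) (n : ℕ) → concat (replicate n u) ≡ pow u n
  pow-concat u zero = refl
  pow-concat u (suc n) = cong (u ++_) (pow-concat u n)

  -- A power of `u` may shed a copy of `u` at its front and regain it at its end, so a prefix that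
  -- loses one period is still a prefix.
  prefix-period : (u : List A) (m : ℕ) (π : List A) {ρ : List A} → pow u m ≡ π ++ ρ → length u ≤ length π →
    ∃₂ λ π₁ ρ₁ → π ≡ u ++ π₁ × pow u m ≡ π₁ ++ ρ₁
  prefix-period [] zero π {ρ} e l = π , ρ , refl , e
  prefix-period (a ∷ u) zero [] e ()
  prefix-period u (suc m) π {ρ} e l with split-++ u π e l
  ... | π₁ , refl , e₂ = π₁ , ρ ++ u , refl ,
        trans (sym (pow-comm u m)) (trans (cong (_++ u) e₂) (++-assoc π₁ ρ u))

  -- With |u| + |v| in place of the optimal bound |u| + |v| - gcd (|u| , |v|).
  fine-wilf : (u v : List A) (m n : ℕ) (π : List A) {ρ τ : List A} → pow u m ≡ π ++ ρ → pow v n ≡ π ++ τ →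
    length u + length v ≤ length π → u ++ v ≡ v ++ u
  fine-wilf u v m n π {ρ} {τ} e₁ e₂ l
    with prefix-period u m π e₁ (≤-trans (m≤m+n _ _) l)
       | prefix-period v n π e₂ (≤-trans (m≤n+m _ (length u)) l)
  ... | π₁ , ρ₁ , p₁ , q₁ | π₂ , ρ₂ , p₂ , q₂
    -- The prefix `π₁` of `pow u m` begins with `v`, because `pow u m` does and `π₁` is long enough;
    -- likewise `π₂` begins with `u`. So `π` begins both with `u ++ v` and with `v ++ u`.
    with split-++ v π₁ (trans (sym (trans e₁ (trans (cong (_++ ρ) p₂) (++-assoc v π₂ ρ)))) q₁)
           (+-cancelˡ-≤ (length u) _ _ (≤-trans l (≤-reflexive (trans (cong length p₁) (length-++ u)))))
       | split-++ u π₂ (trans (sym (trans e₂ (trans (cong (_++ τ) p₁) (++-assoc u π₁ τ)))) q₂)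
           (+-cancelˡ-≤ (length v) _ _ (≤-trans (≤-reflexive (+-comm (length v) (length u)))
              (≤-trans l (≤-reflexive (trans (cong length p₂) (length-++ v))))))
  ... | π₃ , refl , _ | π₄ , refl , _ =
    proj₁ (split-≡ (u ++ v) (v ++ u)
      (trans (++-assoc u v π₃) (trans (sym p₁) (trans p₂ (sym (++-assoc v u π₄)))))
      (trans (length-++ u) (trans (+-comm (length u) _) (sym (length-++ v)))))

  prefix-chunk : (u : List A) (m : ℕ) (w : List A) {ζ : List A} → pow u m ≡ w ++ ζ →
    ∃₂ λ j t → j ≤ m × w ≡ pow u j ++ t × Infix t u
  prefix-chunk u zero [] e = 0 , [] , z≤n , refl , [] , u , refl
  prefix-chunk u (suc m) w {ζ} e with ≤-total (length u) (length w)
  ... | inj₂ l with split-++ w u (sym e) l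
  ...   | r , e₁ , _ = 0 , w , z≤n , refl , [] , r , e₁
  prefix-chunk u (suc m) w {ζ} e | inj₁ l with split-++ u w e l
  ...   | r , refl , e₂ with prefix-chunk u m r e₂
  ...   | j , t , j≤ , refl , i = suc j , t , s≤s j≤ , sym (++-assoc u (pow u j) t) , i

  -- `s` is the end of the period in which `w` starts and `t` the beginning of the one in which it
  -- ends; if `w` lies within one period, `s` is all of `w`. Both are recorded only as infixes of
  -- `u`, which serves the length estimates as well as the search for markers.
  infix-chunk : (u : List A) (m : ℕ) {w : List A} → Infix w (pow u m) →
    ∃₂ λ s j → ∃ λ t → j ≤ m × w ≡ s ++ pow u j ++ t × Infix s u × Infix t u
  infix-chunk u zero {[]} ([] , ζ , e) = [] , 0 , [] , z≤n , refl , ([] , u , refl) , ([] , u , refl)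
  infix-chunk u (suc m) {w} (ξ , ζ , e) with ≤-total (length u) (length ξ)
  ... | inj₁ l with split-++ u ξ e l
  ...   | r , refl , e₂ with infix-chunk u m (r , ζ , e₂)
  ...   | s , j , t , j≤ , rest = s , j , t , m≤n⇒m≤1+n j≤ , rest
  infix-chunk u (suc m) {w} (ξ , ζ , e) | inj₂ l with split-++ ξ u (sym e) l
  ...   | β , refl , e₂ with ≤-total (length w) (length β)
  ...     | inj₁ l′ with split-++ w β e₂ l′
  ...       | r , refl , _ = w , 0 , [] , z≤n , sym (++-identityʳ w) , (ξ , r , refl) , ([] , u , refl)
  infix-chunk u (suc m) {w} (ξ , ζ , e) | inj₂ l | β , refl , e₂ | inj₂ l′ with split-++ β w (sym e₂) l′
  ...       | r , refl , e₃ with prefix-chunk u m r e₃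
  ...       | j , t , j≤ , refl , i = β , j , t , m≤n⇒m≤1+n j≤ , refl ,
                (ξ , [] , cong (ξ ++_) (sym (++-identityʳ β))) , i

  chunk-length : (u s t : List A) (j : ℕ) → Infix s u → Infix t u →
    length (s ++ pow u j ++ t) ≤ (2 + j) * length u
  chunk-length u s t j i₁ i₂ = begin
    length (s ++ pow u j ++ t) ≡⟨ length-++ s ⟩
    length s + length (pow u j ++ t) ≡⟨ cong (length s +_) (length-++ (pow u j)) ⟩
    length s + (length (pow u j) + length t) ≡⟨ cong (length s +_) (+-comm (length (pow u j)) _) ⟩
    length s + (length t + length (pow u j)) ≤⟨ +-mono-≤ (infix-length i₁)
        (+-mono-≤ (infix-length i₂) (≤-reflexive (length-pow u j))) ⟩
    length u + (length u + j * length u) ∎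
    where open ≤-Reasoning

  -- The infix starts within a period `ξ ++ β`; what follows `β` has the length of `ξ` and is the
  -- beginning of the next period.
  infix-rotation : (u : List A) (m : ℕ) {w : List A} → Infix w (pow u m) → length w ≡ length u →
    ∃₂ λ α β → u ≡ α ++ β × w ≡ β ++ α
  infix-rotation [] m {[]} i l = [] , [] , refl , refl
  infix-rotation (a ∷ u) zero {[]} i ()
  infix-rotation (a ∷ u) zero {b ∷ w} ([] , ζ , ()) l
  infix-rotation (a ∷ u) zero {b ∷ w} (_ ∷ _ , ζ , ()) l
  infix-rotation u@(_ ∷ _) (suc m) {w} (ξ , ζ , e) l with ≤-total (length u) (length ξ)
  ... | inj₁ l′ with split-++ u ξ e l′
  ...   | r , refl , e₂ = infix-rotation u m (r , ζ , e₂) l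
  infix-rotation u@(_ ∷ _) (suc m) {w} (ξ , ζ , e) l | inj₂ l′ with split-++ ξ u (sym e) l′
  ...   | β , q , e₂ with split-++ β w (sym e₂)
            (≤-trans (≤-trans (m≤n+m (length β) (length ξ)) (≤-reflexive
                (sym (trans (cong length q) (length-++ ξ))))) (≤-reflexive (sym l)))
  ...     | r , refl , e₃ = ξ , β , q , cong (β ++_) (lemma m e₃)
    where
    lr : length r ≡ length ξ
    lr = +-cancelˡ-≡ (length β) _ _ (begin
      length β + length r ≡⟨ length-++ β ⟨
      length (β ++ r) ≡⟨ l ⟩
      length u ≡⟨ cong length q ⟩
      length (ξ ++ β) ≡⟨ length-++ ξ ⟩
      length ξ + length β ≡⟨ +-comm (length ξ) _ ⟩
      length β + length ξ ∎)
      where open ≡-Reasoning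
    len0 : (r ξ : List A) → length r ≡ length ξ → r ≡ [] → r ≡ ξ
    len0 [] [] _ _ = refl
    lemma : ∀ m → pow u m ≡ r ++ ζ → r ≡ ξ
    -- If no further period follows, `r` is empty, and so is `ξ`, which has the same length.
    lemma zero e₃ = len0 r ξ lr (++-conicalˡ r ζ (sym e₃))
    lemma (suc m) e₃ = proj₁ (split-≡ r ξ (trans (sym e₃) (trans (cong (_++ pow u m) q) (++-assoc ξ β _))) lr)

-- Inverses, cancellation and cyclically reduced words

last-winv : (w : Word k) → last (winv w) ≡ Maybe.map invL (head w)
last-winv [] = refl
last-winv (a ∷ w) = trans (cong last (winv-∷ a w)) (last-∷ʳ (winv w) (invL a))

head-winv : (w : Word k) → head (winv w) ≡ Maybe.map invL (last w)
head-winv w with initLast w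
... | [] = refl
... | w′ ∷ʳ′ a = trans (cong head (winv-++ w′ (a ∷ []))) (cong (Maybe.map invL) (sym (last-∷ʳ w′ a)))

winv-≢[] : {w : Word k} → w ≢ [] → winv w ≢ []
winv-≢[] {w = w} n e = n (trans (sym (winv-invol w)) (cong winv e))

winv-injective : {u v : Word k} → winv u ≡ winv v → u ≡ v
winv-injective {u = u} {v} e = trans (sym (winv-invol u)) (trans (cong winv e) (winv-invol v))

infix-winv : {u v : Word k} → Infix u v → Infix (winv u) (winv v)
infix-winv {u = u} (ξ , ζ , refl) = winv ζ , winv ξ ,
  trans (winv-++ ξ (u ++ ζ)) (trans (cong (_++ winv ξ) (winv-++ u ζ)) (++-assoc (winv ζ) _ _))

winv-pow : (u : Word k) (n : ℕ) → winv (pow u n) ≡ pow (winv u) n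
winv-pow u zero = refl
winv-pow u (suc n) = trans (winv-++ u (pow u n)) (trans (cong (_++ winv u) (winv-pow u n))
    (pow-comm (winv u) n))

nc-++ˡ : (u : Word k) {v w : Word k} → v ≢ [] → NC v w → NC (u ++ v) w
nc-++ˡ u n c p = c (trans (sym (last-++ u n)) p)

nc-++ʳ : {u v : Word k} (w : Word k) → v ≢ [] → NC u v → NC u (v ++ w)
nc-++ʳ {v = v} w n c p q = c p (trans (sym (head-++ v n)) q)

nc-++ˡ⁻ : (u : Word k) {v w : Word k} → v ≢ [] → NC (u ++ v) w → NC v w
nc-++ˡ⁻ u n c p = c (trans (last-++ u n) p)

nc-++ʳ⁻ : {u v : Word k} (w : Word k) → v ≢ [] → NC u (v ++ w) → NC u v
nc-++ʳ⁻ {v = v} w n c p q = c p (trans (head-++ v n) q)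

map-invL-just : (m : Maybe (Letter k)) {a : Letter k} → Maybe.map invL m ≡ just a → m ≡ just (invL a)
map-invL-just (just b) refl = cong just (sym (invL-invol b))

nc-winv : {u v : Word k} → NC u v → NC (winv v) (winv u)
nc-winv {u = u} {v} c {a} {b} p q e =
  c (map-invL-just (last u) (trans (sym (head-winv u)) q)) (map-invL-just (head v)
      (trans (sym (last-winv v)) p))
    (trans (sym e) (sym (invL-invol a)))

red-++ : {u v : Word k} → Red u → Red v → NC u v → Red (u ++ v)
red-++ [] s c = s
red-++ {v = []} [-] s c = [-]
red-++ {v = b ∷ v} [-] s c = c refl refl ∷ s
red-++ (p ∷ r) s c = p ∷ red-++ r s c

red-++⁻ˡ : (u : Word k) {v : Word k} → Red (u ++ v) → Red u
red-++⁻ˡ [] r = []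
red-++⁻ˡ (a ∷ []) r = [-]
red-++⁻ˡ (a ∷ b ∷ u) (p ∷ r) = p ∷ red-++⁻ˡ (b ∷ u) r

red-++⁻ʳ : (u : Word k) {v : Word k} → Red (u ++ v) → Red v
red-++⁻ʳ [] r = r
red-++⁻ʳ (a ∷ u) r = red-++⁻ʳ u (red-tail r)

red-nc : (u : Word k) {v : Word k} → Red (u ++ v) → NC u v
red-nc (a ∷ []) {b ∷ v} (p ∷ r) refl refl = p
red-nc (a ∷ b ∷ u) (p ∷ r) = red-nc (b ∷ u) r

red-infix : {u v : Word k} → Infix u v → Red v → Red u
red-infix {u = u} (ξ , ζ , refl) r = red-++⁻ˡ u (red-++⁻ʳ ξ r)

red-winv : {u : Word k} → Red u → Red (winv u)
red-winv {u = []} r = []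
red-winv {u = a ∷ u} r = subst Red (sym (winv-∷ a u))
  (red-++ (red-winv (red-tail r)) [-] (nc-winv {u = a ∷ []} {v = u} (red-nc (a ∷ []) r)))

Cyc : Word k → Set
Cyc u = Red u × NC u u

cyc-pow-nc : {u : Word k} → Cyc u → u ≢ [] → (n : ℕ) → NC u (pow u n)
cyc-pow-nc c n zero p ()
cyc-pow-nc {u = u} c n (suc m) = nc-++ʳ {u = u} {v = u} (pow u m) n (proj₂ c)

red-pow : {u : Word k} → Cyc u → u ≢ [] → (n : ℕ) → Red (pow u n)
red-pow c n zero = []
red-pow c n (suc m) = red-++ (proj₁ c) (red-pow c n m) (cyc-pow-nc c n m)

cyc-intro : (u : Word k) → Red (u ++ u) → Cyc u
cyc-intro u r = red-++⁻ˡ u r , red-nc u r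

cyc-winv : {u : Word k} → Cyc u → Cyc (winv u)
cyc-winv {u = u} (r , c) = red-winv r , nc-winv {u = u} {v = u} c

cyc? : (u : Word k) → NC u u ⊎ ∃₂ λ l v → u ≡ l ∷ v ++ invL l ∷ []
cyc? [] = inj₁ λ ()
cyc? (a ∷ w) with initLast w
... | [] = inj₁ λ { refl refl → a≢invLa a }
... | v ∷ʳ′ b with b ≟L invL a
...   | yes refl = inj₂ (a , v , refl)
...   | no n = inj₁ λ { p refl e → n (trans (just-injective (trans (sym (last-∷ʳ (a ∷ v) b)) p)) e) }

cyclic-core : (u : Word k) → Red u → ∃₂ λ p w → u ≡ p ++ w ++ winv p × Cyc w
cyclic-core {k = k} u r = go (length u) u ≤-refl r
  where
  go : ∀ n (u : Word k) → length u ≤ n → Red u → ∃₂ λ p w → u ≡ p ++ w ++ winv p × Cyc w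
  go n u l r with cyc? u
  ... | inj₁ c = [] , u , sym (++-identityʳ u) , r , c
  go (suc n) _ (s≤s l) r | inj₂ (a , v , refl)
    with go n v (≤-trans (m≤m+n (length v) 1) (≤-trans (≤-reflexive (sym (length-++ v))) l))
        (red-infix (a ∷ [] , invL a ∷ [] , refl) r)
  ... | p , w , refl , c = a ∷ p , w , cong (a ∷_) (begin
          (p ++ w ++ winv p) ++ invL a ∷ [] ≡⟨ ++-assoc p _ _ ⟩
          p ++ (w ++ winv p) ++ invL a ∷ [] ≡⟨ cong (p ++_) (++-assoc w _ _) ⟩
          p ++ w ++ winv p ++ invL a ∷ [] ≡⟨ cong (λ z → p ++ w ++ z) (winv-∷ a p) ⟨
          p ++ w ++ winv (a ∷ p) ∎) , c
    where open ≡-Reasoning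

-- With an empty core the last letter of `p` would stand next to its own inverse.
core-≢[] : (p : Word k) {w : Word k} → Red (p ++ w ++ winv p) → p ++ w ++ winv p ≢ [] → w ≢ []
core-≢[] [] r n refl = n refl
core-≢[] (a ∷ p) r n refl with initLast p
... | [] = red-nc (a ∷ []) r refl refl (sym (invL-invol a))
... | p′ ∷ʳ′ b = red-nc (a ∷ p′ ++ b ∷ []) {winv (a ∷ p′ ++ b ∷ [])} r (last-∷ʳ (a ∷ p′) b)
        (trans (head-winv (a ∷ p′ ++ b ∷ [])) (cong (Maybe.map invL) (last-∷ʳ (a ∷ p′) b))) (sym (invL-invol b))

-- The free group has no element of order two: the core would be its own inverse too, and would end
-- with the inverse of its first letter, against cyclic reducedness.
winv-fixed : {w : Word k} → Red w → w ≡ winv w → w ≡ []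
winv-fixed {w = []} r e = refl
winv-fixed {k = k} {u@(_ ∷ _)} r e with cyclic-core u r
... | p , w , q , c = ⊥-elim (nc (w) w≢ (proj₂ c) e₁)
  where
  w≢ : w ≢ []
  w≢ = core-≢[] p (subst Red q r) (λ z → case (trans q z))
    where case : u ≢ []
          case ()
  e₁ : w ≡ winv w
  e₁ = proj₁ (split-≡ w (winv w) (proj₂ (split-≡ p p (trans (sym q) (trans e (trans (cong winv q)
         (trans (winv-++ p (w ++ winv p)) (trans (cong (_++ winv p)
             (trans (winv-++ w (winv p)) (cong (_++ winv w) (winv-invol p)))) (++-assoc p _ _)))))) refl))
         (sym (length-winv w)))
  nc : (w : Word k) → w ≢ [] → NC w w → w ≢ winv w
  nc [] n c e = n refl
  nc (a ∷ w) n c e = c (trans (cong last e) (last-winv (a ∷ w))) refl refl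

-- By `infix-rotation`, `u` is `α ++ β` with inverse `β ++ α`. Comparison of lengths shows that `α`
-- and `β` are their own inverses, hence empty.
no-inverse-infix : {u : Word k} → Red u → u ≢ [] → (m : ℕ) → ¬ Infix (winv u) (pow u m)
no-inverse-infix {u = u} r n m i with infix-rotation u m i (length-winv u)
... | α , β , refl , e = n (cong₂ _++_
        (winv-fixed (red-++⁻ˡ α r) (sym (proj₂ es)))
        (winv-fixed (red-++⁻ʳ α r) (sym (proj₁ es))))
  where
  es : winv β ≡ β × winv α ≡ α
  es = split-≡ (winv β) β (trans (sym (winv-++ α β)) e) (length-winv β)

-- Rotations and conjugates

Rot : Word k → Word k → Set
Rot f w = ∃₂ λ α β → f ≡ α ++ β × w ≡ β ++ α

rot-head : {f w : Word k} {b : Letter k} → Rot f (b ∷ w) → Rot f (w ++ b ∷ [])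
rot-head {w = w} {b} (α , [] , refl , refl) = b ∷ [] , w , ++-identityʳ (b ∷ w) , refl
rot-head {w = w} {b} (α , _ ∷ β , refl , refl) = α ++ b ∷ [] , β , sym (++-assoc α _ β) , ++-assoc β α _

rot-last : {f w : Word k} {b : Letter k} → Rot f (w ++ b ∷ []) → Rot f (b ∷ w)
rot-last {w = w} {b} (α , β , refl , e) with initLast α
... | [] = w , b ∷ [] , trans (sym (++-identityʳ β)) (sym e) , refl
... | α′ ∷ʳ′ c with ∷ʳ-injective w (β ++ α′) (trans e (sym (++-assoc β α′ _)))
...   | refl , refl = α′ , b ∷ β , ++-assoc α′ _ β , refl

-- A rotation need not be an infix of the word itself, but its square is an infix of the cube. In
-- this way properties of powers pass to rotations.
rotation-cube : {A : Set} (α β : List A) → pow (α ++ β) 3 ≡ α ++ ((β ++ α) ++ (β ++ α)) ++ β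
rotation-cube α β = begin
  (α ++ β) ++ (α ++ β) ++ (α ++ β) ++ [] ≡⟨ cong (λ z → (α ++ β) ++ (α ++ β) ++ z) (++-identityʳ (α ++ β)) ⟩
  (α ++ β) ++ (α ++ β) ++ (α ++ β) ≡⟨ ++-assoc α β _ ⟩
  α ++ β ++ (α ++ β) ++ (α ++ β) ≡⟨ cong (λ z → α ++ β ++ z) (++-assoc α β _) ⟩
  α ++ β ++ α ++ β ++ (α ++ β) ≡⟨ cong (α ++_) (++-assoc β α _) ⟨
  α ++ (β ++ α) ++ β ++ (α ++ β) ≡⟨ cong (λ z → α ++ (β ++ α) ++ z) (++-assoc β α β) ⟨
  α ++ (β ++ α) ++ (β ++ α) ++ β ≡⟨ cong (α ++_) (++-assoc (β ++ α) _ β) ⟨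
  α ++ ((β ++ α) ++ (β ++ α)) ++ β ∎
  where open ≡-Reasoning

cyc-rot : {f w : Word k} → Cyc f → f ≢ [] → Rot f w → Cyc w
cyc-rot c n (α , β , refl , refl) = cyc-intro (β ++ α) (red-infix (α , β , rotation-cube α β) (red-pow c n 3))

rot-≢[] : {f w : Word k} → f ≢ [] → Rot f w → w ≢ []
rot-≢[] n (α , β , refl , refl) e = n (cong₂ _++_ (++-conicalʳ β α e) (++-conicalˡ β α e))

Conj : Word k → Word k → Set
Conj f z = ∃ λ h → h ++ f ++ winv h ≈ z

conj-trans : {f z z′ : Word k} (g : Word k) → Conj f z → g ++ z ++ winv g ≈ z′ → Conj f z′
conj-trans {f = f} {z} g (h , p) q = g ++ h , ≈-trans
  (group-identity (g V.∷ h V.∷ f V.∷ V.[]) ((x₀ · x₁) · (x₂ · ((x₀ · x₁) ⁻¹)))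
      (x₀ · ((x₁ · (x₂ · (x₁ ⁻¹))) · (x₀ ⁻¹))) refl)
  (≈-trans (++-cong-≈ (≈-refl {u = g}) (++-cong-≈ p ≈-refl)) q)

-- Induction on `h`. A new letter cancels against the first letter of `p`; or, when `p` is empty, it
-- cancels a letter at one end of `w` that reappears at the other end, which rotates `w`; otherwise
-- it lengthens `p`.
conjugate-form : {f : Word k} → Cyc f → f ≢ [] → (h : Word k) →
  ∃₂ λ p w → Rot f w × Red (p ++ w ++ winv p) × h ++ f ++ winv h ≈ p ++ w ++ winv p
conjugate-form {f = f} c n [] = [] , f , ([] , f , refl , sym (++-identityʳ f)) , subst Red
    (sym (++-identityʳ f)) (proj₁ c) , ≈-refl
conjugate-form {k = k} {f} c n (l ∷ h) with conjugate-form c n h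
... | p , w , rot , r , e = step p w rot r
      (≈-trans (group-identity ((l ∷ []) V.∷ h V.∷ f V.∷ V.[]) ((x₀ · x₁) · (x₂ · ((x₀ · x₁) ⁻¹)))
          (x₀ · ((x₁ · (x₂ · (x₁ ⁻¹))) · (x₀ ⁻¹))) refl)
        (++-cong-≈ (≈-refl {u = l ∷ []}) (++-cong-≈ e ≈-refl)))
  where
  G = (l ∷ h) ++ f ++ winv (l ∷ h)
  extend : ∀ p w → Red (p ++ w ++ winv p) → p ++ w ≢ [] → (∀ {b} → head (p ++ w) ≡ just b → l ≢ invL b) →
    (∀ {b} → last (w ++ winv p) ≡ just b → b ≢ l) → Red ((l ∷ p) ++ w ++ winv (l ∷ p))
  extend p w r ne hd ls = subst Red eq₁
    (red-++ [-] (red-++ r [-] (λ { q refl q′ → ls (trans (sym (last-++ p ne′)) q) (trans q′ (invL-invol l)) }))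
      λ { refl q → hd (hd′ q) })
    where
    eq₁ : l ∷ (p ++ w ++ winv p) ++ invL l ∷ [] ≡ (l ∷ p) ++ w ++ winv (l ∷ p)
    eq₁ = cong (l ∷_) (trans (++-assoc p _ _) (cong (p ++_) (trans (++-assoc w _ _)
        (cong (w ++_) (sym (winv-∷ l p))))))
    ne′ : w ++ winv p ≢ []
    ne′ e = ne (cong₂ _++_ (trans (sym (winv-invol p)) (cong winv (++-conicalʳ w _ e))) (++-conicalˡ w _ e))
    hd′ : ∀ {b} → head ((p ++ w ++ winv p) ++ invL l ∷ []) ≡ just b → head (p ++ w) ≡ just b
    hd′ q = trans (sym (head-++ (p ++ w) {winv p ++ invL l ∷ []} ne)) (trans (cong head
      (trans (++-assoc p w _) (trans (cong (p ++_) (sym (++-assoc w _ _))) (sym (++-assoc p _ _))))) q)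
  step : ∀ p w → Rot f w → Red (p ++ w ++ winv p) → G ≈ (l ∷ []) ++ (p ++ w ++ winv p) ++ invL l ∷ [] →
    ∃₂ λ p w → Rot f w × Red (p ++ w ++ winv p) × G ≈ p ++ w ++ winv p
  step (b ∷ p) w rot r e with l ≟L invL b
  ... | yes refl = p , w , rot , red-infix (b ∷ [] , invL b ∷ [] ,
                     cong (b ∷_) (trans (cong (λ z → p ++ w ++ z) (winv-∷ b p))
                         (sym (trans (++-assoc p _ _) (cong (p ++_) (++-assoc w _ _)))))) r ,
                   ≈-trans e (≈-trans (≡⇒≈ (cong (λ z → (invL b ∷ []) ++
                       ((b ∷ p) ++ w ++ winv (b ∷ p)) ++ z ∷ []) (invL-invol b)))
                     (group-identity ((b ∷ []) V.∷ p V.∷ w V.∷ V.[])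
                     ((x₀ ⁻¹) · (((x₀ · x₁) · (x₂ · ((x₀ · x₁) ⁻¹))) · x₀)) (x₁ · (x₂ · (x₁ ⁻¹))) refl))
  ... | no l≢ = l ∷ b ∷ p , w , rot ,
                extend (b ∷ p) w r (λ ()) (λ { refl → l≢ })
                  (λ q q′ → l≢ (sym (trans (just-injective (trans (sym (last-winv (b ∷ p)))
                      (trans (sym (last-++ w (winv-≢[] {w = b ∷ p} (λ ())))) q))) q′))) ,
                ≈-trans e (group-identity ((l ∷ []) V.∷ (b ∷ p) V.∷ w V.∷ V.[])
                  (x₀ · ((x₁ · (x₂ · (x₁ ⁻¹))) · (x₀ ⁻¹))) ((x₀ · x₁) · (x₂ · ((x₀ · x₁) ⁻¹))) refl)
  step [] [] rot r e = ⊥-elim (rot-≢[] n rot refl)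
  step [] w@(b ∷ w₁) rot r e with l ≟L invL b
  ... | yes refl = [] , w₁ ++ b ∷ [] , rot-head rot ,
                   subst Red (sym (++-identityʳ (w₁ ++ b ∷ []))) (proj₁ (cyc-rot c n (rot-head rot))) ,
                   ≈-trans e (≈-trans (≡⇒≈ (cong (λ z → (invL b ∷ []) ++ ((b ∷ w₁) ++ []) ++ z ∷ [])
                       (invL-invol b)))
                     (group-identity ((b ∷ []) V.∷ w₁ V.∷ V.[]) ((x₀ ⁻¹) · (((x₀ · x₁) · one) · x₀))
                         ((x₁ · x₀) · one) refl))
  ... | no l≢ with unsnoc b w₁
  ...   | w₂ , d , q with d ≟L l
  ...     | yes refl = [] , l ∷ w₂ , rot-last rot′ ,
                   subst Red (sym (++-identityʳ (l ∷ w₂))) (proj₁ (cyc-rot c n (rot-last rot′))) ,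
                   ≈-trans e (≈-trans (≡⇒≈ (cong (λ z → (l ∷ []) ++ (z ++ []) ++ invL l ∷ []) q))
                     (group-identity ((l ∷ []) V.∷ w₂ V.∷ V.[]) (x₀ · (((x₁ · x₀) · one) · (x₀ ⁻¹)))
                         ((x₀ · x₁) · one) refl))
    where rot′ = subst (Rot f) q rot
  ...     | no d≢ = l ∷ [] , w , rot ,
                   extend [] w r (λ ()) (λ { refl → l≢ })
                     (λ q₁ q₂ → d≢ (trans (just-injective (trans (sym (last-∷ʳ w₂ d))
                         (trans (cong last (trans (sym q) (sym (++-identityʳ w)))) q₁))) q₂)) ,
                   ≈-trans e (group-identity ((l ∷ []) V.∷ w V.∷ V.[]) (x₀ · ((x₁ · one) · (x₀ ⁻¹)))
                       (x₀ · (x₁ · (x₀ ⁻¹))) refl)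

reduced-conjugate : {f z : Word k} → Cyc f → f ≢ [] → Red z → Conj f z →
  ∃₂ λ p w → Rot f w × z ≡ p ++ w ++ winv p
reduced-conjugate c n r (h , e) with conjugate-form c n h
... | p , w , rot , s , e′ = p , w , rot , red-unique r s (≈-trans (≈-sym e) e′)

-- A nonempty `p` would make the last letter of `z` inverse to the first.
cyclic-conjugate : {f z : Word k} → Cyc f → f ≢ [] → Cyc z → Conj f z → Rot f z
cyclic-conjugate c n (r , nc) h with reduced-conjugate c n r h
... | [] , w , rot , refl = subst (Rot _) (sym (++-identityʳ w)) rot
... | b ∷ p , w , rot , refl = ⊥-elim (nc (trans ends (last-winv (b ∷ p))) refl refl)
  where
  ends : last (b ∷ p ++ w ++ winv (b ∷ p)) ≡ last (winv (b ∷ p))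
  ends = trans (cong (last ∘ (b ∷_)) (sym (++-assoc p w _))) (last-++ (b ∷ p ++ w) (winv-≢[] {w = b ∷ p} λ ()))

-- Products of two powers

pow-cong : {u v : Word k} (n : ℕ) → u ≈ v → pow u n ≈ pow v n
pow-cong zero e = ≈-refl
pow-cong (suc n) e = ++-cong-≈ e (pow-cong n e)

pow-conj : (g u : Word k) (n : ℕ) → pow (g ++ u ++ winv g) n ≈ g ++ pow u n ++ winv g
pow-conj g u zero = ≈-sym (winv-inverseʳ g)
pow-conj g u (suc n) = ≈-trans (++-cong-≈ (≈-refl {u = g ++ u ++ winv g}) (pow-conj g u n))
  (group-identity (g V.∷ u V.∷ pow u n V.∷ V.[]) ((x₀ · (x₁ · (x₀ ⁻¹))) · (x₀ · (x₂ · (x₀ ⁻¹))))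
      (x₀ · ((x₁ · x₂) · (x₀ ⁻¹))) refl)

conj-cancel : (g : Word k) {u v : Word k} → g ++ u ++ winv g ≈ g ++ v ++ winv g → u ≈ v
conj-cancel g {u} {v} e = ≈-trans (lemma u) (≈-trans (++-cong-≈ (≈-refl {u = winv g})
    (++-cong-≈ e (≈-refl {u = g}))) (≈-sym (lemma v)))
  where
  lemma : ∀ u → u ≈ winv g ++ (g ++ u ++ winv g) ++ g
  lemma u = group-identity (g V.∷ u V.∷ V.[]) x₁ ((x₀ ⁻¹) · ((x₀ · (x₁ · (x₀ ⁻¹))) · x₀)) refl

-- The last component expresses maximality: `A` and `B` do not begin with the same letter. In this
-- form it is the absence of cancellation when `A ++ winv B` is closed up cyclically.
common-prefix : (T S : Word k) → ∃₂ λ π A → ∃ λ B → T ≡ π ++ A × S ≡ π ++ B × NC (winv B) A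
common-prefix [] S = [] , [] , S , refl , refl , λ _ ()
common-prefix (a ∷ T) [] = [] , a ∷ T , [] , refl , refl , λ ()
common-prefix (a ∷ T) (b ∷ S) with a ≟L b
... | no n = [] , a ∷ T , b ∷ S , refl , refl ,
      λ { p refl e → n (sym (invL-injective (trans (just-injective (trans (sym (last-winv (b ∷ S))) p)) e))) }
... | yes refl with common-prefix T S
...   | π , A , B , refl , refl , c = a ∷ π , A , B , refl , refl , λ {x} {y} → c {x} {y}

common-suffix : (T S : Word k) → ∃₂ λ σ A → ∃ λ B → T ≡ A ++ σ × S ≡ B ++ σ × NC A (winv B)
common-suffix T S with common-prefix (winv T) (winv S)
... | π , A , B , p , q , c = winv π , winv A , winv B , flip T A p , flip S B q ,
    nc-winv {u = winv B} {v = A} c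
  where
  flip : ∀ T A → winv T ≡ π ++ A → T ≡ winv A ++ winv π
  flip T A p = trans (sym (winv-invol T)) (trans (cong winv p) (winv-++ π A))

fine-wilf-suffix : (u v : Word k) (m n : ℕ) (A B σ : Word k) → pow u m ≡ A ++ σ → pow v n ≡ B ++ σ →
  length u + length v ≤ length σ → u ++ v ≡ v ++ u
fine-wilf-suffix u v m n A B σ p q l = sym (winv-injective (trans (winv-++ v u) (trans
  (fine-wilf (winv u) (winv v) m n (winv σ)
    (trans (sym (winv-pow u m)) (trans (cong winv p) (winv-++ A σ)))
    (trans (sym (winv-pow v n)) (trans (cong winv q) (winv-++ B σ)))
    (≤-trans (≤-reflexive (cong₂ _+_ (length-winv u) (length-winv v)))
        (≤-trans l (≤-reflexive (sym (length-winv σ))))))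
  (sym (winv-++ u v)))))

conj-winv : {f z : Word k} → Conj f z → Conj (winv f) (winv z)
conj-winv {f = f} (h , e) = h , ≈-trans (group-identity (h V.∷ f V.∷ V.[]) (x₀ · ((x₁ ⁻¹) · (x₀ ⁻¹)))
    ((x₀ · (x₁ · (x₀ ⁻¹))) ⁻¹) refl) (winv-cong-≈ e)

rot-winv : {f w : Word k} → Rot (winv f) w → Rot f (winv w)
rot-winv {f = f} (α , β , p , refl) = winv β , winv α ,
  trans (sym (winv-invol f)) (trans (cong winv p) (winv-++ α β)) , winv-++ β α

winv-concat : (Ps : List (Word k)) → winv (concat Ps) ≡ concat (reverse (map winv Ps))
winv-concat [] = refl
winv-concat (P ∷ Ps) = begin
  winv (P ++ concat Ps) ≡⟨ winv-++ P (concat Ps) ⟩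
  winv (concat Ps) ++ winv P ≡⟨ cong₂ _++_ (winv-concat Ps) (sym (++-identityʳ (winv P))) ⟩
  concat (reverse (map winv Ps)) ++ concat (winv P ∷ []) ≡⟨ concat-++ (reverse (map winv Ps)) (winv P ∷ []) ⟩
  concat (reverse (map winv Ps) ++ winv P ∷ []) ≡⟨ cong concat (unfold-reverse (winv P) (map winv Ps)) ⟨
  concat (reverse (map winv (P ∷ Ps))) ∎
  where open ≡-Reasoning

-- Length estimates and long infixes of powers

length-nonzero : {A : Set} (u : List A) → u ≢ [] → NonZero (length u)
length-nonzero [] n = ⊥-elim (n refl)
length-nonzero (_ ∷ _) n = _

-- The source of the number 14. Two common ends of length at most `2 * ℓ` leave `10 * ℓ`; two more
-- ends of length at most `3 * ℓ`, removed in `stripped-long`, leave `4 * ℓ`, enough for two full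
-- periods between incomplete ones.
middle-long : ∀ {m ℓ π a σ} → 14 ≤ m → m * ℓ ≡ π + a + σ → π ≤ 2 * ℓ → σ ≤ 2 * ℓ → 10 * ℓ ≤ a
middle-long {m} {ℓ} {π} {a} {σ} 14≤m e p s = +-cancelʳ-≤ (4 * ℓ) (10 * ℓ) a (begin
  10 * ℓ + 4 * ℓ ≡⟨ *-distribʳ-+ ℓ 10 4 ⟨
  14 * ℓ ≤⟨ *-monoˡ-≤ ℓ 14≤m ⟩
  m * ℓ ≡⟨ e ⟩
  π + a + σ ≤⟨ +-mono-≤ (+-monoˡ-≤ a p) s ⟩
  2 * ℓ + a + 2 * ℓ ≡⟨ cong (_+ 2 * ℓ) (+-comm (2 * ℓ) a) ⟩
  a + 2 * ℓ + 2 * ℓ ≡⟨ +-assoc a _ _ ⟩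
  a + (2 * ℓ + 2 * ℓ) ≡⟨ cong (a +_) (*-distribʳ-+ ℓ 2 2) ⟨
  a + 4 * ℓ ∎)
  where open ≤-Reasoning

end-long : ∀ {n ℓ π b σ} .{{_ : NonZero ℓ}} → 14 ≤ n → n * ℓ ≡ π + b + σ → b ≤ 3 * ℓ → 3 * ℓ ≤ π ⊎ 3 * ℓ ≤ σ
end-long {n} {ℓ} {π} {b} {σ} 14≤n e l with ≤-total (3 * ℓ) π | ≤-total (3 * ℓ) σ
... | inj₁ p | _ = inj₁ p
... | inj₂ _ | inj₁ s = inj₂ s
... | inj₂ p | inj₂ s = ⊥-elim (<⇒≱ (≤-trans (m≤n+m 10 4) ≤-refl) (*-cancelʳ-≤ 14 9 ℓ (begin
  14 * ℓ ≤⟨ *-monoˡ-≤ ℓ 14≤n ⟩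
  n * ℓ ≡⟨ e ⟩
  π + b + σ ≤⟨ +-mono-≤ (+-mono-≤ p l) s ⟩
  3 * ℓ + 3 * ℓ + 3 * ℓ ≡⟨ cong (_+ 3 * ℓ) (*-distribʳ-+ ℓ 3 3) ⟨
  6 * ℓ + 3 * ℓ ≡⟨ *-distribʳ-+ ℓ 6 3 ⟨
  9 * ℓ ∎)))
  where open ≤-Reasoning

stripped-long : ∀ {ℓ a p w} → 10 * ℓ ≤ a → a ≡ p + (w + p) → p ≤ 3 * ℓ → 4 * ℓ ≤ w
stripped-long {ℓ} {a} {p} {w} l e q = +-cancelʳ-≤ (6 * ℓ) (4 * ℓ) w (begin
  4 * ℓ + 6 * ℓ ≡⟨ *-distribʳ-+ ℓ 4 6 ⟨
  10 * ℓ ≤⟨ l ⟩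
  a ≡⟨ e ⟩
  p + (w + p) ≡⟨ +-comm p _ ⟩
  w + p + p ≡⟨ +-assoc w p p ⟩
  w + (p + p) ≤⟨ +-monoʳ-≤ w (+-mono-≤ q q) ⟩
  w + (3 * ℓ + 3 * ℓ) ≡⟨ cong (w +_) (*-distribʳ-+ ℓ 3 3) ⟨
  w + 6 * ℓ ∎)
  where open ≤-Reasoning

module _ {A : Set} where

  -- Each of the two incomplete ends is at most as long as `u`, which accounts for the 2 in
  -- `x ≤ 2 + j`.
  long-infix-chunk : ∀ x (u : List A) → u ≢ [] → (m : ℕ) {w : List A} → Infix w (pow u m) →
      x * length u ≤ length w →
    ∃₂ λ s j → ∃ λ t → j ≤ m × x ≤ 2 + j × w ≡ s ++ pow u j ++ t × Infix s u × Infix t u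
  long-infix-chunk x u n m i l with infix-chunk u m i
  ... | s , j , t , j≤ , refl , i₁ , i₂ = s , j , t , j≤ ,
    *-cancelʳ-≤ x (2 + j) (length u) {{length-nonzero u n}} (≤-trans l (chunk-length u s t j i₁ i₂)) ,
        refl , i₁ , i₂

  pow-+ : (u : List A) (i j : ℕ) → pow u (i + j) ≡ pow u i ++ pow u j
  pow-+ u zero j = refl
  pow-+ u (suc i) j = trans (cong (u ++_) (pow-+ u i j)) (sym (++-assoc u _ _))

  pow-prefix : (u : List A) {i j : ℕ} → i ≤ j → ∃ λ r → pow u j ≡ pow u i ++ r
  pow-prefix u {i} l with m≤n⇒∃[o]m+o≡n l
  ... | o , refl = pow u o , pow-+ u i o

  pow-suffix : (u : List A) {i j : ℕ} → i ≤ j → ∃ λ r → pow u j ≡ r ++ pow u i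
  pow-suffix u {i} l with m≤n⇒∃[o]m+o≡n l
  ... | o , refl = pow u o , trans (cong (pow u) (+-comm i o)) (pow-+ u o i)

  short-prefix : (u : List A) {i m : ℕ} (π : List A) {ρ : List A} → i ≤ m → pow u m ≡ π ++ ρ →
    length π ≤ i * length u → Infix π (pow u i)
  short-prefix u {i} π l e q with pow-prefix u l
  ... | r , e′ with split-++ π (pow u i) (trans (sym e) e′) (≤-trans q (≤-reflexive (sym (length-pow u i))))
  ...   | r′ , e″ , _ = [] , r′ , e″

  short-suffix : (u : List A) {i m : ℕ} (A₀ σ : List A) → i ≤ m → pow u m ≡ A₀ ++ σ →
    length σ ≤ i * length u → Infix σ (pow u i)
  short-suffix u {i} {m} A₀ σ l e q with pow-suffix u l
  ... | r , e′ with split-++ r A₀ (trans (sym e′) e) (+-cancelʳ-≤ (length σ) _ _ (begin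
          length r + length σ ≤⟨ +-monoʳ-≤ (length r) q ⟩
          length r + i * length u ≡⟨ cong (length r +_) (length-pow u i) ⟨
          length r + length (pow u i) ≡⟨ length-++ r ⟨
          length (r ++ pow u i) ≡⟨ cong length (trans (sym e′) e) ⟩
          length (A₀ ++ σ) ≡⟨ length-++ A₀ ⟩
          length A₀ + length σ ∎))
      where open ≤-Reasoning
  ...   | r′ , _ , e″ = r′ , [] , trans e″ (cong (r′ ++_) (sym (++-identityʳ σ)))

all-reverse : {A : Set} {P : A → Set} {xs : List A} → All P xs → All P (reverse xs)
all-reverse [] = []
all-reverse {P = P} {x ∷ xs} (p ∷ ps) = subst (All P) (sym (unfold-reverse x xs))
    (All.++⁺ (all-reverse ps) (p ∷ []))

infix-concat : {A : Set} (Ps : List (List A)) → All (λ P → Infix P (concat Ps)) Ps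
infix-concat [] = []
infix-concat (P ∷ Ps) = infix-++ʳ (concat Ps) infix-refl ∷ All.map (infix-++ˡ P) (infix-concat Ps)

empty? : {A : Set} (u : List A) → u ≡ [] ⊎ u ≢ []
empty? [] = inj₁ refl
empty? (_ ∷ _) = inj₂ λ ()

-- Words composed of few pieces whose markers all recur

module Repetition {k : ℕ} (C : ℕ → Word k → Set)
  (C-infix : ∀ {N P Q} → Infix P Q → C N P → C N Q)
  (C-winv : ∀ {N P} → C N P → C N (winv P)) where

  -- `C N` stands for the presence of a marker of kind `N` or of its inverse. Cutting the word in
  -- two makes the occurrences disjoint.
  Twice : ℕ → Word k → Set
  Twice N w = ∃₂ λ α β → w ≡ α ++ β × C N α × C N β

  twice-++ˡ : ∀ {N} (γ : Word k) {w : Word k} → Twice N w → Twice N (γ ++ w)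
  twice-++ˡ γ (α , β , refl , a , b) = γ ++ α , β , sym (++-assoc γ α β) , C-infix
      (infix-++ˡ γ infix-refl) a , b

  twice-++ʳ : ∀ {N} (γ : Word k) {w : Word k} → Twice N w → Twice N (w ++ γ)
  twice-++ʳ γ (α , β , refl , a , b) = α , β ++ γ , ++-assoc α β γ , a , C-infix (infix-++ʳ γ infix-refl) b

  twice-winv : ∀ {N} {w : Word k} → Twice N w → Twice N (winv w)
  twice-winv (α , β , refl , a , b) = winv β , winv α , winv-++ α β , C-winv b , C-winv a

  -- Nothing is asked of markers that straddle the border of two pieces; this is why the number of
  -- pieces has to be bounded.
  Repetitive : ℕ → Word k → Set
  Repetitive L w = ∃ λ Ps → concat Ps ≡ w × length Ps ≤ L × All (λ P → ∀ N → C N P → Twice N w) Ps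

  rep-++ : ∀ {L₁ L₂ w₁ w₂} → Repetitive L₁ w₁ → Repetitive L₂ w₂ → Repetitive (L₁ + L₂) (w₁ ++ w₂)
  rep-++ {w₁ = w₁} {w₂} (Ps , refl , l , a) (Qs , refl , l′ , b) =
    Ps ++ Qs , sym (concat-++ Ps Qs) , ≤-trans (≤-reflexive (length-++ Ps)) (+-mono-≤ l l′) ,
    All.++⁺ (All.map (λ f N c → twice-++ʳ w₂ (f N c)) a) (All.map (λ f N c → twice-++ˡ w₁ (f N c)) b)

  rep-winv : ∀ {L w} → Repetitive L w → Repetitive L (winv w)
  rep-winv (Ps , refl , l , a) = reverse (map winv Ps) , sym (winv-concat Ps) ,
    ≤-trans (≤-reflexive (trans (length-reverse (map winv Ps)) (length-map winv Ps))) l ,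
    all-reverse (All.map⁺ (All.map (λ {P} f N c → twice-winv
        (f N (C-infix (≡⇒infix (winv-invol P)) (C-winv c)))) a))
    where
    ≡⇒infix : {u v : Word k} → u ≡ v → Infix u v
    ≡⇒infix refl = infix-refl

  rep-≤ : ∀ {L L′ w} → L ≤ L′ → Repetitive L w → Repetitive L′ w
  rep-≤ le (Ps , e , l , a) = Ps , e , ≤-trans l le , a

  -- All rotations are included because a product of powers is compared with `f` only up to
  -- conjugation.
  Simple : ℕ → Word k → Set
  Simple L f = ∀ {w} → Rot f w → ¬ Repetitive L w

  simple-winv : ∀ {L f} → Simple L f → Simple L (winv f)
  simple-winv s rot r = s (rot-winv rot) (rep-winv r)

  chunks : Word k → Word k → ℕ → Word k → List (Word k)
  chunks s u j t = s ∷ replicate j u ++ t ∷ []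

  concat-chunks : ∀ s u j t → concat (chunks s u j t) ≡ s ++ pow u j ++ t
  concat-chunks s u j t = cong (s ++_) (trans (sym (concat-++ (replicate j u) (t ∷ [])))
    (cong₂ _++_ (pow-concat u j) (++-identityʳ t)))

  length-chunks : ∀ s u j t → length (chunks s u j t) ≡ 2 + j
  length-chunks s u j t = cong suc (trans (length-++ (replicate j u))
      (trans (cong (_+ 1) (length-replicate j)) (+-comm j 1)))

  all-chunks : ∀ {P : Word k → Set} s u j t → P s → P u → P t → All P (chunks s u j t)
  all-chunks s u j t a b c = a ∷ All.++⁺ (All.replicate⁺ j b) (c ∷ [])

  twice-pow : ∀ {N} u j → 2 ≤ j → C N u → Twice N (pow u j)
  twice-pow u (suc (suc j)) _ c = u , u ++ pow u j , refl , c , C-infix (infix-++ʳ (pow u j) infix-refl) c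
  twice-pow u 1 (s≤s ()) c

  -- A marker in any of the pieces lies in `u`, and `u` occurs at least twice.
  rep-chunks : ∀ {m} s u j t → j ≤ m → 2 ≤ j → Infix s u → Infix t u → Repetitive (2 + m) (s ++ pow u j ++ t)
  rep-chunks s u j t j≤m 2≤j i₁ i₂ = chunks s u j t , concat-chunks s u j t ,
    ≤-trans (≤-reflexive (length-chunks s u j t)) (s≤s (s≤s j≤m)) ,
    all-chunks s u j t (λ N → tw N ∘ C-infix i₁) tw (λ N → tw N ∘ C-infix i₂)
    where
    tw : ∀ N → C N u → Twice N (s ++ pow u j ++ t)
    tw N c = twice-++ˡ s (twice-++ʳ t (twice-pow u j 2≤j c))

  -- A marker in `p` recurs, inverted, in `winv p`; one in `u` recurs in another period.
  rep-conjugate : ∀ p u m → 2 ≤ m → Repetitive (2 + m) (p ++ pow u m ++ winv p)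
  rep-conjugate p u m 2≤m = chunks p u m (winv p) , concat-chunks p u m (winv p) ,
    ≤-reflexive (length-chunks p u m (winv p)) ,
    all-chunks p u m (winv p) tp (λ N c → twice-++ˡ p (twice-++ʳ (winv p) (twice-pow u m 2≤m c)))
      (λ N c → tp N (subst (C _) (winv-invol p) (C-winv c)))
    where
    tp : ∀ N → C N p → Twice N (p ++ pow u m ++ winv p)
    tp N c = p , pow u m ++ winv p , refl , c , C-infix (infix-++ˡ (pow u m) infix-refl) (C-winv c)

  first-part : (p u : Word k) (m : ℕ) → p ++ pow u (suc m) ++ winv p ≡ (p ++ u) ++ pow u m ++ winv p
  first-part p u m = trans (cong (p ++_) (++-assoc u _ _)) (sym (++-assoc p u _))

  last-part : (p u : Word k) (m : ℕ) → p ++ pow u (suc m) ++ winv p ≡ (p ++ pow u m) ++ u ++ winv p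
  last-part p u m = trans (cong (λ z → p ++ z ++ winv p) (sym (pow-comm u m)))
    (trans (cong (p ++_) (++-assoc (pow u m) u _)) (sym (++-assoc p _ _)))

  red-core-pow : (p u : Word k) (m : ℕ) → Red (p ++ u ++ winv p) → Cyc u → u ≢ [] →
    Red (p ++ pow u (suc m) ++ winv p)
  red-core-pow p u m r c n = red-++ (red-++⁻ˡ p r)
    (red-++ (red-pow c n (suc m)) (red-++⁻ʳ u (red-++⁻ʳ p r))
      (subst (λ z → NC z (winv p)) (pow-comm u m) (nc-++ˡ (pow u m) n (red-nc u (red-++⁻ʳ p r)))))
    (subst (NC p) (sym (++-assoc u _ _)) (nc-++ʳ {u = p} (pow u m ++ winv p) n
        (nc-++ʳ⁻ {u = p} (winv p) n (red-nc p r))))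

  module _ {f : Word k} (cyc : Cyc f) (f≢ : f ≢ []) where

    -- Here `v` plays the part of the inverse of the second base. Each power is the conjugate of a
    -- power of a core, and their product is cyclically reduced as it stands. It is thus a rotation
    -- of `f`, and `rep-conjugate` applies to both factors.
    no-cancellation : ∀ {L m n u v} → Simple L f → 2 ≤ m → 2 ≤ n → 4 + (m + n) ≤ L →
      Red u → Red v → u ≢ [] → v ≢ [] → NC u v → NC v u → Conj f (pow u m ++ pow v n) → ⊥
    no-cancellation {m = suc m} {suc n} {u} {v} s 2≤m 2≤n l ru rv u≢ v≢ c₁ c₂ cj
      with cyclic-core u ru | cyclic-core v rv
    ... | p , u₀ , refl , cu | q , v₀ , refl , cv =
      s (cyclic-conjugate cyc f≢ (rz , ncz) cj′)
        (rep-≤ (≤-trans (≤-reflexive (cong (2 +_) (+-comm-lemma (suc m) (suc n)))) l)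
          (rep-++ (rep-conjugate p u₀ (suc m) 2≤m) (rep-conjugate q v₀ (suc n) 2≤n)))
      where
      +-comm-lemma : ∀ a b → a + (2 + b) ≡ 2 + (a + b)
      +-comm-lemma a b = trans (+-suc a (suc b)) (cong suc (+-suc a b))
      u₀≢ : u₀ ≢ []
      u₀≢ = core-≢[] p ru u≢
      v₀≢ : v₀ ≢ []
      v₀≢ = core-≢[] q rv v≢
      U V z : Word k
      U = p ++ pow u₀ (suc m) ++ winv p
      V = q ++ pow v₀ (suc n) ++ winv q
      z = U ++ V
      cj′ : Conj f z
      cj′ = proj₁ cj , ≈-trans (proj₂ cj) (++-cong-≈ (pow-conj p u₀ (suc m)) (pow-conj q v₀ (suc n)))
      nc : ∀ p u m q v n → u ≢ [] → v ≢ [] → NC (p ++ u ++ winv p) (q ++ v ++ winv q) →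
        NC (p ++ pow u (suc m) ++ winv p) (q ++ pow v (suc n) ++ winv q)
      nc p u m q v n u≢ v≢ c = subst₂ NC (sym (last-part p u m)) (sym (first-part q v n))
        (nc-++ˡ (p ++ pow u m) (++-≢[]ˡ (winv p) u≢) (nc-++ʳ {u = u ++ winv p} _ (++-≢[]ʳ q v≢)
          (nc-++ˡ⁻ p (++-≢[]ˡ (winv p) u≢) (nc-++ʳ⁻ {u = p ++ u ++ winv p} (winv q) (++-≢[]ʳ q v≢)
            (subst (NC (p ++ u ++ winv p)) (sym (++-assoc q v _)) c)))))
      U≢ : U ≢ []
      U≢ = subst (_≢ []) (sym (first-part p u₀ m)) (++-≢[]ˡ _ (++-≢[]ʳ p u₀≢))
      V≢ : V ≢ []
      V≢ = subst (_≢ []) (sym (first-part q v₀ n)) (++-≢[]ˡ _ (++-≢[]ʳ q v₀≢))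
      rz : Red z
      rz = red-++ (red-core-pow p u₀ m ru cu u₀≢) (red-core-pow q v₀ n rv cv v₀≢) (nc p u₀ m q v₀ n u₀≢ v₀≢ c₁)
      ncz : NC z z
      ncz = nc-++ˡ U V≢ (nc-++ʳ {u = V} V U≢ (nc q v₀ n p u₀ m v₀≢ u₀≢ c₂))

    -- `A` is a conjugate `p ++ w ++ winv p` of a rotation `w` of `f`. A long `p` would contain `u`,
    -- so that the inverse of `u` would occur in a power of `u`. With a short `p`, the infix `w`
    -- contains two full periods and is repetitive.
    infix-of-power : ∀ {L m u A} → Simple L f → Cyc u → u ≢ [] → Infix A (pow u m) → 10 * length u ≤ length A →
      2 + m ≤ L → Conj f A → ⊥
    infix-of-power {m = m} {u} s cu u≢ i lA l cj with reduced-conjugate cyc f≢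
        (red-infix i (red-pow cu u≢ m)) cj
    ... | p , w , rot , refl with ≤-total (3 * length u) (length p)
    ... | inj₁ le = u-in-p (long-infix-chunk 3 u u≢ m (infix-trans ([] , w ++ winv p , refl) i) le)
      where
      u-in-p : (∃₂ λ s j → ∃ λ t → j ≤ m × 3 ≤ 2 + j × p ≡ s ++ pow u j ++ t × Infix s u × Infix t u) → ⊥
      u-in-p (s₁ , zero , t , _ , s≤s (s≤s ()) , _)
      u-in-p (s₁ , suc j , t , _ , _ , e , _) = no-inverse-infix (proj₁ cu) u≢ m (infix-trans
        (infix-winv {u = u} {v = p} (s₁ , pow u j ++ t , trans e (cong (s₁ ++_) (++-assoc u _ t))))
        (infix-trans (p ++ w , [] , trans (sym (++-assoc p w _))
            (cong ((p ++ w) ++_) (sym (++-identityʳ _)))) i))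
    ... | inj₂ le with long-infix-chunk 4 u u≢ m (infix-trans (p , winv p , refl) i)
               (stripped-long {length u} lA (trans (length-++ p)
                   (cong (length p +_) (trans (length-++ w) (cong (length w +_) (length-winv p))))) le)
    ... | s₁ , j , t , j≤ , s≤s (s≤s 2≤j) , refl , i₁ , i₂ = s rot (rep-≤ l (rep-chunks s₁ u j t j≤ 2≤j i₁ i₂))

    -- Cancellation removes the common suffix `σ` and prefix `π` of the two powers. By Fine and Wilf
    -- neither is as long as `u` and `v` together, so most of `pow u m` survives as `A′`. If the
    -- remainder `B′` of `pow v n` is nonempty, `A′ ++ winv B′` is a rotation of `f`.
    cyclically-reduced : ∀ {L m n u v} → Simple L f → 14 ≤ m → 14 ≤ n → 4 + (m + n) ≤ L → Cyc u → Cyc v →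
        u ≢ [] → v ≢ [] →
      length v ≤ length u → u ++ v ≢ v ++ u → Conj f (pow u m ++ winv (pow v n)) → ⊥
    cyclically-reduced {L} {m} {n} {u} {v} s 14≤m 14≤n l cu cv u≢ v≢ v≤u uv≢ cj
      with common-suffix (pow u m) (pow v n)
    ... | σ , A , B , eA , eB , nc₁ with common-prefix A B
    ... | π , A′ , B′ , refl , refl , nc₂ = finish
      where
      lu = length u
      ℓ≤ : lu + length v ≤ 2 * lu
      ℓ≤ = +-monoʳ-≤ lu (≤-trans v≤u (≤-reflexive (sym (+-identityʳ lu))))
      eA′ : pow u m ≡ π ++ A′ ++ σ
      eA′ = trans eA (++-assoc π A′ σ)
      eB′ : pow v n ≡ π ++ B′ ++ σ
      eB′ = trans eB (++-assoc π B′ σ)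
      lπ : length π ≤ 2 * lu
      lπ = ≤-trans (≰⇒≥ λ le → uv≢ (fine-wilf u v m n π eA′ eB′ le)) ℓ≤
      lσ : length σ ≤ 2 * lu
      lσ = ≤-trans (≰⇒≥ λ le → uv≢ (fine-wilf-suffix u v m n _ _ σ eA eB le)) ℓ≤
      lens : ∀ u m {A : Word k} → pow u m ≡ (π ++ A) ++ σ → m * length u ≡ length π + length A + length σ
      lens u m {A} e = trans (sym (length-pow u m)) (trans (cong length e)
          (trans (length-++ (π ++ A)) (cong (_+ length σ) (length-++ π))))
      lA : 10 * lu ≤ length A′
      lA = middle-long {m} {lu} {length π} 14≤m (lens u m eA) lπ lσ
      iA : Infix A′ (pow u m)
      iA = π , σ , eA′
      iB : Infix B′ (pow v n)
      iB = π , σ , eB′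
      z : Word k
      z = A′ ++ winv B′
      cj′ : Conj f z
      cj′ = conj-trans (winv π) cj (≈-trans (≡⇒≈ (cong₂ (λ x y → winv π ++ (x ++ winv y) ++ winv
          (winv π)) eA′ eB′))
        (group-identity (π V.∷ A′ V.∷ B′ V.∷ σ V.∷ V.[])
          ((x₀ ⁻¹) · (((x₀ · (x₁ · x₃)) · ((x₀ · (x₂ · x₃)) ⁻¹)) · ((x₀ ⁻¹) ⁻¹))) (x₁ · (x₂ ⁻¹)) refl))
      rA : Red A′
      rA = red-infix iA (red-pow cu u≢ m)
      rB : Red B′
      rB = red-infix iB (red-pow cv v≢ n)
      A′≢ : A′ ≢ []
      A′≢ refl = <⇒≱ (s≤s z≤n) (≤-trans (*-cancelʳ-≤ 10 0 lu {{length-nonzero u u≢}} lA) z≤n)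
      degenerate : B′ ≡ [] → ⊥
      degenerate e = infix-of-power s cu u≢ iA lA (≤-trans (m≤n⇒m≤1+n (m≤n⇒m≤1+n (+-monoʳ-≤ 2 (m≤m+n m n)))) l)
        (subst (Conj f) (trans (cong (λ z → A′ ++ winv z) e) (++-identityʳ A′)) cj′)
      generic : B′ ≢ [] → ⊥
      generic B′≢ = cut (long-infix-chunk 10 u u≢ m iA lA) (infix-chunk v n iB)
       where
       cut : (∃₂ λ s j → ∃ λ t → j ≤ m × 10 ≤ 2 + j × A′ ≡ s ++ pow u j ++ t × Infix s u × Infix t u) →
         (∃₂ λ s j → ∃ λ t → j ≤ n × B′ ≡ s ++ pow v j ++ t × Infix s v × Infix t v) → ⊥
       cut (s₁ , j , t , j≤ , s≤s (s≤s 8≤j) , eA″ , i₁ , i₂) (s₂ , i , t₂ , i≤ , eB″ , i₃ , i₄) = contra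
           (2 ≤? i)
        where
        2≤j : 2 ≤ j
        2≤j = ≤-trans (s≤s (s≤s z≤n)) 8≤j
        nc : NC A′ (winv B′)
        nc = nc-++ʳ⁻ {u = A′} (winv π) (winv-≢[] B′≢) (subst (NC A′) (winv-++ π B′) (nc-++ˡ⁻ π A′≢ nc₁))
        rot : Rot f z
        rot = cyclic-conjugate cyc f≢ (red-++ rA (red-winv rB) nc , nc-++ˡ A′ (winv-≢[] B′≢)
            (nc-++ʳ {u = winv B′} (winv B′) A′≢ nc₂)) cj′
        repA : Repetitive (2 + m) A′
        repA = subst (Repetitive (2 + m)) (sym eA″) (rep-chunks s₁ u j t j≤ 2≤j i₁ i₂)
        L≥ : 2 + m + (2 + n) ≤ L
        L≥ = ≤-trans (≤-reflexive (cong (2 +_) (trans (+-suc m (suc n)) (cong suc (+-suc m n))))) l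
        contra : Dec (2 ≤ i) → ⊥
        contra (yes 2≤i) = s rot (rep-≤ L≥ (rep-++ repA (rep-winv
            (subst (Repetitive (2 + n)) (sym eB″) (rep-chunks s₂ v i t₂ i≤ 2≤i i₃ i₄)))))
        contra (no 2≰i) = s rot (rep-≤ L≥ (mixed repA))
          where
          -- `B′` contains at most one full period of `v`, so its own markers need not recur within
          -- it; they are found in `A′` instead.
          lB : length B′ ≤ 3 * length v
          lB = ≤-trans (≤-reflexive (cong length eB″)) (≤-trans (chunk-length v s₂ t₂ i i₃ i₄)
              (*-monoˡ-≤ (length v) (+-monoʳ-≤ 2 (≤-pred (≰⇒> 2≰i)))))
          inside : ∀ {ρ} → Infix ρ (pow v n) → Infix ρ (pow u 2) → 3 * length v ≤ length ρ → Infix v (pow u 2)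
          inside i₅ i₆ le with long-infix-chunk 3 v v≢ n i₅ le
          ... | s₃ , suc j₃ , t₃ , _ , _ , refl , _ = infix-trans
              (s₃ , pow v j₃ ++ t₃ , cong (s₃ ++_) (++-assoc v _ t₃)) i₆
          ... | s₃ , zero , t₃ , _ , s≤s (s≤s ()) , _
          2≤m : 2 ≤ m
          2≤m = ≤-trans (s≤s (s≤s z≤n)) 14≤m
          -- As `B′` is short, one of `π` and `σ` is long in terms of `v` and contains `v`. Both are
          -- common to the two powers and short in terms of `u`, so they lie in `pow u 2`, which in
          -- turn lies in `A′`.
          v-in : Infix v (pow u 2)
          v-in with end-long {n} {length v} {length π} {{length-nonzero v v≢}} 14≤n (lens v n eB) lB
          ... | inj₁ le = inside ([] , B′ ++ σ , eB′) (short-prefix u π 2≤m eA′ lπ) le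
          ... | inj₂ le = inside (π ++ B′ , [] , trans eB (cong ((π ++ B′) ++_) (sym (++-identityʳ σ))))
              (short-suffix u _ σ 2≤m eA lσ) le
          A-in : Infix (pow u 2) A′
          A-in with pow-prefix u 2≤j
          ... | r , e = s₁ , r ++ t , trans eA″ (cong (s₁ ++_)
              (trans (cong (_++ t) e) (++-assoc (pow u 2) r t)))
          Qs : List (Word k)
          Qs = reverse (map winv (chunks s₂ v i t₂))
          eQ : concat Qs ≡ winv B′
          eQ = trans (sym (winv-concat (chunks s₂ v i t₂))) (cong winv
              (trans (concat-chunks s₂ v i t₂) (sym eB″)))
          lQ : length Qs ≤ 2 + n
          lQ = ≤-trans (≤-reflexive (trans (length-reverse (map winv (chunks s₂ v i t₂)))
              (trans (length-map winv (chunks s₂ v i t₂)) (length-chunks s₂ v i t₂)))) (+-monoʳ-≤ 2 i≤)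
          aQ : All (λ Q → Infix Q (winv v)) Qs
          aQ = all-reverse (All.map⁺ (all-chunks s₂ v i t₂ (infix-winv i₃) infix-refl (infix-winv i₄)))
          mixed : Repetitive (2 + m) A′ → Repetitive (2 + m + (2 + n)) z
          mixed (Ps , eP , lP , aP) = Ps ++ Qs , trans (sym (concat-++ Ps Qs)) (cong₂ _++_ eP eQ) ,
            ≤-trans (≤-reflexive (length-++ Ps)) (+-mono-≤ lP lQ) ,
            All.++⁺ (All.map (λ g N c → twice-++ʳ (winv B′) (g N c)) aP)
              -- A marker in a piece of `winv B′` lies in `winv v`: one occurrence is that piece,
              -- the other is the inverted one in the copy of `v` inside `A′`.
              (All.zipWith (λ { (i₅ , i₆) N c → A′ , winv B′ , refl ,
                 C-infix (infix-trans v-in A-in) (subst (C N) (winv-invol v) (C-winv (C-infix i₅ c))) ,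
                 subst (C N) eQ (C-infix i₆ c) }) (aQ , infix-concat Qs))
      finish : ⊥
      finish = [ degenerate , generic ]′ (empty? B′)

-- Reduction to cyclically reduced bases

Ends : Letter k → Word k → Set
Ends l v = (∃ λ w → v ≡ l ∷ w) ⊎ (∃ λ w → v ≡ w ++ invL l ∷ [])

ends? : (l : Letter k) (v : Word k) → Ends l v ⊎ (head v ≢ just l × last v ≢ just (invL l))
ends? l [] = inj₂ ((λ ()) , λ ())
ends? l (a ∷ v) with a ≟L l
... | yes refl = inj₁ (inj₁ (v , refl))
... | no n with unsnoc a v
...   | w , b , e with b ≟L invL l
...     | yes refl = inj₁ (inj₂ (w , e))
...     | no n′ = inj₂ ((λ { refl → n refl }) , λ q → n′ (just-injective
    (trans (sym (last-∷ʳ w b)) (trans (cong last (sym e)) q))))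

-- One letter cancels and at most one is added, so the conjugate is not longer than `v`.
conjugate-end : (l : Letter k) {v : Word k} → Ends l v →
  ∃ λ v′ → Red v′ × length v′ ≤ length v × v′ ≈ winv (l ∷ []) ++ v ++ winv (winv (l ∷ []))
conjugate-end l (inj₁ (w , refl)) = reduce (w ++ l ∷ []) , red-reduce (w ++ l ∷ []) ,
  ≤-trans (length-reduce (w ++ l ∷ [])) (≤-reflexive (trans (length-++ w) (+-comm (length w) 1))) ,
  ≈-trans (reduce-≈ (w ++ l ∷ [])) (group-identity ((l ∷ []) V.∷ w V.∷ V.[]) (x₁ · x₀)
      ((x₀ ⁻¹) · ((x₀ · x₁) · ((x₀ ⁻¹) ⁻¹))) refl)
conjugate-end l (inj₂ (w , refl)) = reduce (invL l ∷ w) , red-reduce (invL l ∷ w) ,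
  ≤-trans (length-reduce (invL l ∷ w)) (≤-reflexive (sym (trans (length-++ w) (+-comm (length w) 1)))) ,
  ≈-trans (reduce-≈ (invL l ∷ w)) (group-identity ((l ∷ []) V.∷ w V.∷ V.[]) ((x₀ ⁻¹) · x₁)
      ((x₀ ⁻¹) · ((x₁ · (x₀ ⁻¹)) · ((x₀ ⁻¹) ⁻¹))) refl)

conjugate-ends : (l : Letter k) (w : Word k) → w ≈ winv (l ∷ []) ++ (l ∷ w ++ invL l ∷ []) ++ winv
    (winv (l ∷ []))
conjugate-ends l w = group-identity ((l ∷ []) V.∷ w V.∷ V.[]) x₁
    ((x₀ ⁻¹) · ((x₀ · (x₁ · (x₀ ⁻¹))) · ((x₀ ⁻¹) ⁻¹))) refl

length-ends : (l : Letter k) (w : Word k) → suc (length w) ≤ length (l ∷ w ++ invL l ∷ [])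
length-ends l w = s≤s (≤-trans (m≤m+n (length w) 1) (≤-reflexive (sym (length-++ w))))

nc-ends₁ : (l : Letter k) (w v : Word k) → head v ≢ just l → last v ≢ just (invL l) →
  NC (l ∷ w ++ invL l ∷ []) (winv v) × NC (winv v) (l ∷ w ++ invL l ∷ [])
nc-ends₁ l w v h t =
  (λ p q e → t (trans (map-invL-just (last v) (trans (sym (head-winv v)) q))
      (cong just (trans (sym e) (just-injective (trans (sym p) (last-∷ʳ (l ∷ w) (invL l)))))))) ,
  (λ { p refl e → h (trans (map-invL-just (head v) (trans (sym (last-winv v)) p))
      (cong just (trans (cong invL e) (invL-invol l)))) })

nc-ends₂ : (l : Letter k) (w u : Word k) → head u ≢ just l → last u ≢ just (invL l) →
  NC u (winv (l ∷ w ++ invL l ∷ [])) × NC (winv (l ∷ w ++ invL l ∷ [])) u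
nc-ends₂ l w u h t =
  (λ p q e → t (trans p (cong just (trans e (cong invL (trans
      (just-injective (trans (sym q) (trans (head-winv (l ∷ w ++ invL l ∷ []))
          (cong (Maybe.map invL) (last-∷ʳ (l ∷ w) (invL l)))))) (invL-invol l))))))) ,
  (λ p q e → h (trans q (cong just (sym (invL-injective (trans
      (just-injective (trans (sym (last-winv (l ∷ w ++ invL l ∷ []))) p)) e))))))

module _ {k : ℕ} (C : ℕ → Word k → Set)
  (C-infix : ∀ {N P Q} → Infix P Q → C N P → C N Q)
  (C-winv : ∀ {N P} → C N P → C N (winv P)) where

  open Repetition C C-infix C-winv

  module _ {L m n : ℕ} {f : Word k} (cyc : Cyc f) (f≢ : f ≢ []) (simple : Simple L f)
    (14≤m : 14 ≤ m) (14≤n : 14 ≤ n) (l≤ : 4 + (m + n) ≤ L) where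

    private
      2≤m : 2 ≤ m
      2≤m = ≤-trans (s≤s (s≤s z≤n)) 14≤m
      2≤n : 2 ≤ n
      2≤n = ≤-trans (s≤s (s≤s z≤n)) 14≤n

    -- If `v` is the longer word, inversion of the product and of `f` exchanges the two powers.
    both-cyclic : ∀ {u v} → Cyc u → Cyc v → u ≢ [] → v ≢ [] → u ++ v ≢ v ++ u →
      ¬ Conj f (pow u m ++ winv (pow v n))
    both-cyclic {u} {v} cu cv u≢ v≢ uv≢ cj with ≤-total (length v) (length u)
    ... | inj₁ le = cyclically-reduced cyc f≢ simple 14≤m 14≤n l≤ cu cv u≢ v≢ le uv≢ cj
    ... | inj₂ le = cyclically-reduced (cyc-winv cyc) (winv-≢[] f≢) (simple-winv simple) 14≤n 14≤m
          (≤-trans (≤-reflexive (cong (4 +_) (+-comm n m))) l≤) cv cu v≢ u≢ le (uv≢ ∘ sym)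
          (subst (Conj (winv f)) (trans (winv-++ (pow u m) (winv (pow v n)))
              (cong (_++ winv (pow u m)) (winv-invol (pow v n)))) (conj-winv cj))

    -- Induction on the total length. If one word has the form `l w l⁻¹`, then either the other
    -- begins with `l` or ends with `l⁻¹`, and conjugation of both lowers the total length, or
    -- nothing cancels between `u` and `winv v` in either order and `no-cancellation` applies. Two
    -- cyclically reduced words are left to `both-cyclic`.
    not-product : ∀ N u v → length u + length v ≤ N → Red u → Red v → ¬ (u ++ v ≈ v ++ u) →
      ¬ Conj f (pow u m ++ winv (pow v n))
    not-product N [] v le ru rv nc cj = nc (≡⇒≈ (sym (++-identityʳ v)))
    not-product N u@(_ ∷ _) [] le ru rv nc cj = nc (≡⇒≈ (++-identityʳ u))
    not-product (suc N) u@(_ ∷ _) v@(_ ∷ _) (s≤s le) ru rv nc cj = cases (cyc? u) (cyc? v)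
      where
      conjugate : ∀ g {u′ v′} → Red u′ → Red v′ → length u′ + length v′ ≤ N →
        u′ ≈ g ++ u ++ winv g → v′ ≈ g ++ v ++ winv g → ⊥
      conjugate g {u′} {v′} ru′ rv′ le′ eu ev = not-product N u′ v′ le′ ru′ rv′
        (λ e → nc (conj-cancel g (≈-trans (≈-sym (mul u v)) (≈-trans (≈-sym (++-cong-≈ eu ev))
            (≈-trans e (≈-trans (++-cong-≈ ev eu) (mul v u)))))))
        (conj-trans g cj (≈-trans (group-identity (g V.∷ pow u m V.∷ pow v n V.∷ V.[])
            (x₀ · ((x₁ · (x₂ ⁻¹)) · (x₀ ⁻¹))) ((x₀ · (x₁ · (x₀ ⁻¹))) · ((x₀ · (x₂ · (x₀ ⁻¹))) ⁻¹)) refl)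
          (++-cong-≈ (≈-trans (≈-sym (pow-conj g u m)) (pow-cong m (≈-sym eu)))
            (winv-cong-≈ (≈-trans (≈-sym (pow-conj g v n)) (pow-cong n (≈-sym ev)))))))
        where
        mul : ∀ u v → (g ++ u ++ winv g) ++ (g ++ v ++ winv g) ≈ g ++ (u ++ v) ++ winv g
        mul u v = group-identity (g V.∷ u V.∷ v V.∷ V.[]) ((x₀ · (x₁ · (x₀ ⁻¹))) · (x₀ · (x₂ · (x₀ ⁻¹))))
            (x₀ · ((x₁ · x₂) · (x₀ ⁻¹))) refl
      separated : NC u (winv v) × NC (winv v) u → ⊥
      separated (c₁ , c₂) = no-cancellation cyc f≢ simple 2≤m 2≤n l≤ ru (red-winv rv) (λ ())
          (winv-≢[] {w = v} λ ()) c₁ c₂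
        (subst (λ z → Conj f (pow u m ++ z)) (winv-pow v n) cj)
      cases : NC u u ⊎ (∃₂ λ l w → u ≡ l ∷ w ++ invL l ∷ []) → NC v v ⊎
          (∃₂ λ l w → v ≡ l ∷ w ++ invL l ∷ []) → ⊥
      cases (inj₁ cu) (inj₁ cv) = both-cyclic (ru , cu) (rv , cv) (λ ()) (λ ()) (λ e → nc (≡⇒≈ e)) cj
      cases (inj₂ (l , w , e)) _ with ends? l v
      ... | inj₂ (h , t) = separated (subst (λ u → NC u (winv v) × NC (winv v) u) (sym e) (nc-ends₁ l w v h t))
      ... | inj₁ en with conjugate-end l en
      ...   | v′ , rv′ , lv′ , ev = conjugate (winv (l ∷ [])) {w} {v′}
          (red-infix (l ∷ [] , invL l ∷ [] , e) ru) rv′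
              (≤-pred (≤-trans (+-mono-≤ (subst (λ z → suc (length w) ≤ length z) (sym e)
                  (length-ends l w)) lv′) (s≤s le)))
              (subst (λ z → w ≈ winv (l ∷ []) ++ z ++ winv (winv (l ∷ []))) (sym e) (conjugate-ends l w)) ev
      cases (inj₁ _) (inj₂ (l , w , e)) with ends? l u
      ... | inj₂ (h , t) = separated (subst (λ v → NC u (winv v) × NC (winv v) u) (sym e) (nc-ends₂ l w u h t))
      ... | inj₁ en with conjugate-end l en
      ...   | u′ , ru′ , lu′ , eu = conjugate (winv (l ∷ [])) {u′} {w} ru′
          (red-infix (l ∷ [] , invL l ∷ [] , e) rv)
              (≤-pred (≤-trans (≤-reflexive (sym (+-suc (length u′) (length w))))
                (≤-trans (+-mono-≤ lu′ (subst (λ z → suc (length w) ≤ length z) (sym e) (length-ends l w)))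
                    (s≤s le))))
              eu (subst (λ z → w ≈ winv (l ∷ []) ++ z ++ winv (winv (l ∷ []))) (sym e) (conjugate-ends l w))

    power-product-commutes : ∀ u v → f ≈ pow u m ++ winv (pow v n) → ¬ ¬ (u ++ v ≈ v ++ u)
    power-product-commutes u v e nc = not-product _ (reduce u) (reduce v) ≤-refl (red-reduce u) (red-reduce v)
      (λ e′ → nc (≈-trans (++-cong-≈ (≈-sym (reduce-≈ u)) (≈-sym (reduce-≈ v)))
          (≈-trans e′ (++-cong-≈ (reduce-≈ v) (reduce-≈ u)))))
      ([] , ≈-trans (≡⇒≈ (++-identityʳ f)) (≈-trans e
        (++-cong-≈ (pow-cong m (≈-sym (reduce-≈ u))) (winv-cong-≈ (pow-cong n (≈-sym (reduce-≈ v)))))))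

-- Words with many markers

module _ {j : ℕ} where

  -- The sign applies to all letters, so that the two markers for the same `N` are inverse to each
  -- other and `Marked` is closed under inversion.
  marker : Bool → ℕ → Word (2 + j)
  marker b N = (suc zero , b) ∷ replicate N (zero , b) ++ (suc zero , b) ∷ []

  Marked : ℕ → Word (2 + j) → Set
  Marked N w = ∃ λ b → Infix (marker b N) w

  marked-infix : ∀ {N P Q} → Infix P Q → Marked N P → Marked N Q
  marked-infix i (b , i′) = b , infix-trans i′ i

  winv-replicate : ∀ N (a : Letter (2 + j)) → winv (replicate N a) ≡ replicate N (invL a)
  winv-replicate zero a = refl
  winv-replicate (suc N) a = trans (winv-∷ a (replicate N a))
      (trans (cong (_++ invL a ∷ []) (winv-replicate N a)) (snoc N))
    where
    snoc : ∀ N → replicate N (invL a) ++ invL a ∷ [] ≡ replicate (suc N) (invL a)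
    snoc zero = refl
    snoc (suc N) = cong (invL a ∷_) (snoc N)

  winv-marker : ∀ b N → winv (marker b N) ≡ marker (not b) N
  winv-marker b N = trans (winv-∷ (suc zero , b) (replicate N (zero , b) ++ (suc zero , b) ∷ []))
    (cong (_++ (suc zero , not b) ∷ []) (trans (winv-++ (replicate N (zero , b)) ((suc zero , b) ∷ []))
      (cong ((suc zero , not b) ∷_) (winv-replicate N (zero , b)))))

  marked-winv : ∀ {N P} → Marked N P → Marked N (winv P)
  marked-winv {N} {P} (b , i) = not b , subst (λ z → Infix z (winv P)) (winv-marker b N) (infix-winv i)

  open Repetition Marked (λ {N} → marked-infix {N}) (λ {N} → marked-winv {N})

  hit : ℕ → ℕ → ℕ
  hit N r with r ≟ℕ N
  ... | yes _ = 1
  ... | no _ = 0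

  hit-≡ : ∀ N → hit N N ≡ 1
  hit-≡ N with N ≟ℕ N
  ... | yes _ = refl
  ... | no n = ⊥-elim (n refl)

  hit-≢ : ∀ {N r} → r ≢ N → hit N r ≡ 0
  hit-≢ {N} {r} n with r ≟ℕ N
  ... | yes e = ⊥-elim (n e)
  ... | no _ = refl

  hit-≤1 : ∀ N r → hit N r ≤ 1
  hit-≤1 N r with r ≟ℕ N
  ... | yes _ = ≤-refl
  ... | no _ = z≤n

  -- The number of gaps of exactly N letters between consecutive occurrences of the
  -- second generator, signs being ignored; r is the length of the gap already read,
  -- so that initially r > N means that no gap has been opened yet.
  gaps : ℕ → ℕ → Word (2 + j) → ℕ
  gaps N r [] = 0
  gaps N r ((suc zero , _) ∷ w) = hit N r + gaps N 0 w
  gaps N r ((zero , _) ∷ w) = gaps N (suc r) w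
  gaps N r ((suc (suc _) , _) ∷ w) = gaps N (suc r) w

  -- A gap that already exceeds `N` cannot be counted any more; the two counts can differ only in
  -- the hit that closes the first gap.
  gaps-dead : ∀ {N r r′} → N < r′ → ∀ w → gaps N r′ w ≤ gaps N r w
  gaps-dead l [] = z≤n
  gaps-dead {N} {r} {r′} l ((suc zero , _) ∷ w) =
    ≤-trans (≤-reflexive (cong (_+ gaps N 0 w) (hit-≢ {N} {r′} (λ e → <-irrefl (sym e) l))))
        (m≤n+m (gaps N 0 w) (hit N r))
  gaps-dead l ((zero , _) ∷ w) = gaps-dead (m≤n⇒m≤1+n l) w
  gaps-dead l ((suc (suc _) , _) ∷ w) = gaps-dead (m≤n⇒m≤1+n l) w

  -- The count in `v` starts from a gap that can never be counted, so the left side contains no gap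
  -- across the cut.
  gaps-++ : ∀ {N r r′} → N < r′ → ∀ u v → gaps N r u + gaps N r′ v ≤ gaps N r (u ++ v)
  gaps-++ l [] v = gaps-dead l v
  gaps-++ {N} {r} {r′} l ((suc zero , _) ∷ u) v =
    ≤-trans (≤-reflexive (+-assoc (hit N r) _ _)) (+-monoʳ-≤ (hit N r) (gaps-++ l u v))
  gaps-++ l ((zero , _) ∷ u) v = gaps-++ l u v
  gaps-++ l ((suc (suc _) , _) ∷ u) v = gaps-++ l u v

  gaps-replicate : ∀ N r M b w → gaps N r (replicate M (zero , b) ++ w) ≡ gaps N (M + r) w
  gaps-replicate N r zero b w = refl
  gaps-replicate N r (suc M) b w = trans (gaps-replicate N (suc r) M b w) (cong (λ z → gaps N z w) (+-suc M r))

  gaps-marker : ∀ N r M b w → gaps N r (marker b M ++ w) ≡ hit N r + (hit N M + gaps N 0 w)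
  gaps-marker N r M b w = cong (hit N r +_) (trans (cong (gaps N 0) (++-assoc (replicate M (zero , b)) _ w))
    (trans (gaps-replicate N 0 M b _) (cong (λ z → hit N z + gaps N 0 w) (+-identityʳ M))))

  marked-gaps : ∀ {N r w} → Marked N w → 1 ≤ gaps N r w
  marked-gaps {N} {r} (b , ξ , ζ , refl) = begin
    1 ≡⟨ hit-≡ N ⟨
    hit N N ≤⟨ m≤m+n (hit N N) _ ⟩
    hit N N + gaps N 0 ζ ≤⟨ m≤n+m _ (hit N (suc N)) ⟩
    hit N (suc N) + (hit N N + gaps N 0 ζ) ≡⟨ gaps-marker N (suc N) N b ζ ⟨
    gaps N (suc N) (marker b N ++ ζ) ≤⟨ m≤n+m _ (gaps N r ξ) ⟩
    gaps N r ξ + gaps N (suc N) (marker b N ++ ζ) ≤⟨ gaps-++ ≤-refl ξ _ ⟩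
    gaps N r (ξ ++ marker b N ++ ζ) ∎
    where open ≤-Reasoning

  twice-gaps : ∀ {N r w} → Twice N w → 2 ≤ gaps N r w
  twice-gaps {N} {r} (α , β , refl , a , b) =
    ≤-trans (+-mono-≤ (marked-gaps {N} {r} a) (marked-gaps {N} {suc N} b)) (gaps-++ ≤-refl α β)

  gaps-short : ∀ {N} r w z → r + length w < N → ∃ λ r′ → r′ ≤ r + length w × gaps N r (w ++ z) ≡ gaps N r′ z
  gaps-short r [] z l = r , m≤m+n r 0 , refl
  gaps-short {N} r ((suc zero , _) ∷ w) z l with gaps-short {N} 0 w z
      (≤-trans (s≤s (≤-trans (n≤1+n _) (m≤n+m _ r))) l)
  ... | r′ , r′≤ , e = r′ , ≤-trans r′≤ (≤-trans (n≤1+n _) (m≤n+m _ r)) ,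
        trans (cong (_+ gaps N 0 (w ++ z)) (hit-≢ {N} {r} (λ e → <-irrefl e (≤-trans (s≤s (m≤m+n r _)) l)))) e
  gaps-short {N} r ((zero , _) ∷ w) z l with gaps-short {N} (suc r) w z
      (≤-trans (≤-reflexive (cong suc (sym (+-suc r _)))) l)
  ... | r′ , r′≤ , e = r′ , ≤-trans r′≤ (≤-reflexive (sym (+-suc r _))) , e
  gaps-short {N} r ((suc (suc _) , _) ∷ w) z l with gaps-short {N} (suc r) w z
      (≤-trans (≤-reflexive (cong suc (sym (+-suc r _)))) l)
  ... | r′ , r′≤ , e = r′ , ≤-trans r′≤ (≤-reflexive (sym (+-suc r _))) , e

  Positive : Word (2 + j) → Set
  Positive = All (λ a → proj₂ a ≡ true)

  positive-≢ : {a b : Letter (2 + j)} → proj₂ a ≡ true → proj₂ b ≡ true → a ≢ invL b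
  positive-≢ {b = i , true} () refl refl

  positive-red : ∀ {w} → Positive w → Red w
  positive-red [] = []
  positive-red (p ∷ []) = [-]
  positive-red (p ∷ q ∷ ps) = positive-≢ p q ∷ positive-red (q ∷ ps)

  positive-last : ∀ {w a} → Positive w → last w ≡ just a → proj₂ a ≡ true
  positive-last (p ∷ []) refl = p
  positive-last (p ∷ q ∷ ps) e = positive-last (q ∷ ps) e

  positive-head : ∀ {w a} → Positive w → head w ≡ just a → proj₂ a ≡ true
  positive-head (p ∷ ps) refl = p

  positive-nc : ∀ {u v} → Positive u → Positive v → NC u v
  positive-nc p q e e′ = positive-≢ (positive-last p e) (positive-head q e′)

  positive-marker : ∀ N → Positive (marker true N)
  positive-marker N = refl ∷ All.++⁺ (All.replicate⁺ N refl) (refl ∷ [])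

  avoid : Maybe (Letter (2 + j)) → Letter (2 + j)
  avoid nothing = zero , true
  avoid (just a) with a ≟L (zero , false)
  ... | yes _ = suc zero , true
  ... | no _ = zero , true

  avoid-positive : ∀ m → proj₂ (avoid m) ≡ true
  avoid-positive nothing = refl
  avoid-positive (just a) with a ≟L (zero , false)
  ... | yes _ = refl
  ... | no _ = refl

  avoid-≢ : ∀ a → a ≢ invL (avoid (just a))
  avoid-≢ a with a ≟L (zero , false)
  ... | yes refl = λ ()
  ... | no n = n

  -- The first and last letters of the blocks are positive and chosen so that the words
  -- block (lo + n - 1) ⋯ block lo c are cyclically reduced as they stand.
  module _ (c : Word (2 + j)) (rc : Red c) where

    first final : Letter (2 + j)
    first = avoid (last c)
    final = avoid (head c)

    -- Between two markers in a power of `word` stand at most `final`, `c` and `first`, that is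
    -- `2 + length c` letters. Gaps of at least `offset` letters thus come from the markers of the
    -- blocks alone.
    offset : ℕ
    offset = 3 + length c

    block : ℕ → Word (2 + j)
    block i = (first ∷ marker true (offset + i)) ++ final ∷ []

    -- The numbers descend, so that `blocks lo n` is a suffix of every longer `blocks lo m`, and the
    -- quotient of the two is again of the form `blocks`.
    blocks : ℕ → ℕ → Word (2 + j)
    blocks lo zero = []
    blocks lo (suc n) = block (lo + n) ++ blocks lo n

    blocks-++ : ∀ lo m n → blocks lo (m + n) ≡ blocks (lo + n) m ++ blocks lo n
    blocks-++ lo zero n = refl
    blocks-++ lo (suc m) n = trans (cong₂ _++_ (cong block (trans (cong (lo +_) (+-comm m n))
        (sym (+-assoc lo n m)))) (blocks-++ lo m n))
      (sym (++-assoc (block (lo + n + m)) _ _))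

    word : ℕ → ℕ → Word (2 + j)
    word lo n = blocks lo n ++ c

    positive-block : ∀ i → Positive (block i)
    positive-block i = All.++⁺ (avoid-positive (last c) ∷ positive-marker (offset + i))
        (avoid-positive (head c) ∷ [])

    positive-blocks : ∀ lo n → Positive (blocks lo n)
    positive-blocks lo zero = []
    positive-blocks lo (suc n) = All.++⁺ (positive-block (lo + n)) (positive-blocks lo n)

    nc-c-blocks : ∀ lo n → NC c (blocks lo (suc n))
    nc-c-blocks lo n {a} q refl = subst (λ m → a ≢ invL (avoid m)) (sym q) (avoid-≢ a)

    last-blocks : ∀ lo n → last (blocks lo (suc n)) ≡ just final
    last-blocks lo zero = trans (cong last (++-identityʳ (block (lo + 0))))
        (last-∷ʳ (first ∷ marker true (offset + (lo + 0))) final)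
    last-blocks lo (suc n) = trans (last-++ (block (lo + suc n)) {blocks lo (suc n)} (λ ())) (last-blocks lo n)

    nc-blocks-c : ∀ lo n → NC (blocks lo n) c
    nc-blocks-c lo zero ()
    nc-blocks-c lo (suc n) {a} {b} q q′ with trans (sym (last-blocks lo n)) q
    ... | refl = λ q″ → avoid-≢ b (trans (sym (invL-invol b)) (cong invL (trans (sym q″) (cong avoid q′))))

    red-word : ∀ lo n → Red (word lo n)
    red-word lo n = red-++ (positive-red (positive-blocks lo n)) rc (nc-blocks-c lo n)

    -- If `c` is empty, blocks meet blocks and positivity excludes cancellation; otherwise the
    -- choice of `first` does.
    nc-word : ∀ lo n lo′ n′ → NC (word lo n) (word lo′ (suc n′))
    nc-word lo n lo′ n′ with empty? c
    ... | inj₁ c≡ = subst (λ z → NC (blocks lo n ++ z) (word lo′ (suc n′))) (sym c≡)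
          (subst (λ z → NC z (word lo′ (suc n′))) (sym (++-identityʳ (blocks lo n)))
          (nc-++ʳ {u = blocks lo n} {v = blocks lo′ (suc n′)} c (λ ())
              (λ {a} {b} → positive-nc (positive-blocks lo n) (positive-blocks lo′ (suc n′)) {a} {b})))
    ... | inj₂ c≢ = nc-++ˡ (blocks lo n) {v = c} {w = word lo′ (suc n′)} c≢
        (nc-++ʳ {u = c} {v = blocks lo′ (suc n′)} c (λ ()) (λ {a} {b} → nc-c-blocks lo′ n′ {a} {b}))

    cyc-word : ∀ lo n → Cyc (word lo (suc n))
    cyc-word lo n = red-word lo (suc n) , nc-word lo (suc n) lo n

    marker-injective : ∀ M N {u v : Word (2 + j)} → marker true M ++ u ≡ marker true N ++ v → M ≡ N
    marker-injective M N q = run M N (trans (sym (++-assoc (replicate M _) _ _))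
        (trans (∷-injectiveʳ q) (++-assoc (replicate N _) _ _)))
      where
      run : ∀ M N {u v : Word (2 + j)} → replicate M (zero , true) ++ (suc zero , true) ∷ u ≡ replicate N
          (zero , true) ++ (suc zero , true) ∷ v → M ≡ N
      run zero zero q = refl
      run zero (suc N) ()
      run (suc M) zero ()
      run (suc M) (suc N) q = cong suc (run M N (∷-injectiveʳ q))

    -- Both products are reduced as they stand, so they agree letter by letter, and in particular in
    -- their first markers.
    word-commute : ∀ lo n lo′ n′ → word lo (suc n) ++ word lo′ (suc n′) ≈ word lo′ (suc n′) ++ word lo
        (suc n) → lo + n ≡ lo′ + n′
    word-commute lo n lo′ n′ q = +-cancelˡ-≡ offset _ _ (marker-injective (offset + (lo + n))
        (offset + (lo′ + n′))
      (∷-injectiveʳ (trans (sym (form lo n _)) (trans eq′ (form lo′ n′ _)))))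
      where
      eq′ : word lo (suc n) ++ word lo′ (suc n′) ≡ word lo′ (suc n′) ++ word lo (suc n)
      eq′ = red-unique (red-++ (red-word lo (suc n)) (red-word lo′ (suc n′)) (nc-word lo (suc n) lo′ n′))
              (red-++ (red-word lo′ (suc n′)) (red-word lo (suc n)) (nc-word lo′ (suc n′) lo n)) q
      form : ∀ lo n z → word lo (suc n) ++ z ≡ first ∷ marker true (offset + (lo + n)) ++
          (final ∷ blocks lo n ++ c) ++ z
      form lo n z = begin
        ((block (lo + n) ++ blocks lo n) ++ c) ++ z ≡⟨ cong (_++ z) (++-assoc (block (lo + n)) _ c) ⟩
        (block (lo + n) ++ blocks lo n ++ c) ++ z ≡⟨ cong (_++ z)
            (++-assoc (first ∷ marker true (offset + (lo + n))) (final ∷ []) _) ⟩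
        ((first ∷ marker true (offset + (lo + n))) ++ final ∷ blocks lo n ++ c) ++ z ≡⟨ ++-assoc
            (first ∷ marker true (offset + (lo + n))) _ z ⟩
        (first ∷ marker true (offset + (lo + n))) ++ (final ∷ blocks lo n ++ c) ++ z ∎
        where open ≡-Reasoning

    reassoc : ∀ lo n z → blocks lo (suc n) ++ z ≡ (first ∷ marker true
        (offset + (lo + n))) ++ final ∷ blocks lo n ++ z
    reassoc lo n z = trans (++-assoc (block (lo + n)) _ z) (++-assoc
        (first ∷ marker true (offset + (lo + n))) (final ∷ []) _)

    gaps-block : ∀ {N} r i z → suc r < N → ∃ λ r′ → r′ ≤ 1 × gaps N r (block i ++ z) ≡ hit N
        (offset + i) + gaps N r′ z
    gaps-block {N} r i z l with gaps-short {N} r (first ∷ []) (marker true (offset + i) ++ final ∷ z)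
        (≤-trans (s≤s (≤-reflexive (+-comm r 1))) l)
      | gaps-short {N} 0 (final ∷ []) z (≤-trans (s≤s (s≤s z≤n)) l)
    ... | r₁ , r₁≤ , q₁ | r₂ , r₂≤ , q₂ = r₂ , r₂≤ , (begin
      gaps N r (block i ++ z) ≡⟨ cong (gaps N r) (++-assoc (first ∷ marker true (offset + i)) (final ∷ []) z) ⟩
      gaps N r ((first ∷ []) ++ marker true (offset + i) ++ final ∷ z) ≡⟨ q₁ ⟩
      gaps N r₁ (marker true (offset + i) ++ final ∷ z) ≡⟨ gaps-marker N r₁ (offset + i) true (final ∷ z) ⟩
      hit N r₁ + (hit N (offset + i) + gaps N 0 (final ∷ z)) ≡⟨ cong
          (_+ (hit N (offset + i) + gaps N 0 (final ∷ z))) (hit-≢ {N} {r₁} (λ q → <-irrefl q r₁<N)) ⟩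
      hit N (offset + i) + gaps N 0 (final ∷ z) ≡⟨ cong (hit N (offset + i) +_) q₂ ⟩
      hit N (offset + i) + gaps N r₂ z ∎)
      where
      open ≡-Reasoning
      r₁<N : r₁ < N
      r₁<N = ≤-trans (s≤s (≤-trans r₁≤ (≤-reflexive (+-comm r 1)))) l


    gaps-blocks-other : ∀ {N} lo n r z → r ≤ 1 → 2 < N → offset + (lo + n) ≤ N →
      ∃ λ r′ → r′ ≤ 1 × gaps N r (blocks lo n ++ z) ≡ gaps N r′ z
    gaps-blocks-other lo zero r z r≤1 2<N l = r , r≤1 , refl
    gaps-blocks-other {N} lo (suc n) r z r≤1 2<N l
      with gaps-block {N} r (lo + n) (blocks lo n ++ z) (≤-trans (s≤s (s≤s r≤1)) 2<N)
    ... | r₁ , r₁≤1 , q₁ with gaps-blocks-other {N} lo n r₁ z r₁≤1 2<N (<⇒≤ below)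
      where
      below : offset + (lo + n) < N
      below = ≤-trans (≤-reflexive (trans (sym (+-suc offset (lo + n)))
          (cong (offset +_) (sym (+-suc lo n))))) l
    ...   | r₂ , r₂≤1 , q₂ = r₂ , r₂≤1 ,
            trans (cong (gaps N r) (++-assoc (block (lo + n)) _ z))
                (trans q₁ (trans (cong (_+ gaps N r₁ (blocks lo n ++ z))
              (hit-≢ {N} (λ q → <-irrefl q (≤-trans (≤-reflexive
                  (trans (sym (+-suc offset (lo + n))) (cong (offset +_) (sym (+-suc lo n))))) l)))) q₂))

    -- The numbers descend, so after a block with a gap of `N` letters all further blocks have
    -- shorter gaps.
    gaps-blocks : ∀ {N} lo n r z → suc r < N → 2 < N →
      ∃ λ r′ → r′ ≤ 1 × gaps N r (blocks lo (suc n) ++ z) ≤ 1 + gaps N r′ z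
    gaps-blocks {N} lo n r z l 2<N with gaps-block {N} r (lo + n) (blocks lo n ++ z) l
    ... | r₁ , r₁≤1 , q₁ = cases (offset + (lo + n) ≟ℕ N)
      where
      q₂ : gaps N r (blocks lo (suc n) ++ z) ≡ hit N (offset + (lo + n)) + gaps N r₁ (blocks lo n ++ z)
      q₂ = trans (cong (gaps N r) (++-assoc (block (lo + n)) _ z)) q₁
      rest : ∀ n → ∃ λ r′ → r′ ≤ 1 × gaps N r₁ (blocks lo n ++ z) ≤ 1 + gaps N r′ z
      rest zero = r₁ , r₁≤1 , n≤1+n _
      rest (suc n) = gaps-blocks lo n r₁ z (≤-trans (s≤s (s≤s r₁≤1)) 2<N) 2<N
      cases : Dec (offset + (lo + n) ≡ N) → ∃ λ r′ → r′ ≤ 1 × gaps N r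
          (blocks lo (suc n) ++ z) ≤ 1 + gaps N r′ z
      cases (no ≢N) with rest n
      ... | r₃ , r₃≤1 , q₃ = r₃ , r₃≤1 , ≤-trans (≤-reflexive
          (trans q₂ (cong (_+ gaps N r₁ (blocks lo n ++ z)) (hit-≢ {N} ≢N)))) q₃
      cases (yes ≡N) with gaps-blocks-other {N} lo n r₁ z r₁≤1 2<N (≤-reflexive ≡N)
      ... | r₃ , r₃≤1 , q₃ = r₃ , r₃≤1 , ≤-trans (≤-reflexive q₂)
          (+-mono-≤ (hit-≤1 N (offset + (lo + n))) (≤-reflexive q₃))

    -- After the last marker at most `final` and `c` are read, so the bound on `r` holds again for
    -- `r′`, and the estimate can be iterated over a power.
    gaps-word : ∀ {N} lo n r z → r ≤ suc (length c) → offset ≤ N →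
      ∃ λ r′ → r′ ≤ suc (length c) × gaps N r (word lo (suc n) ++ z) ≤ 1 + gaps N r′ z
    gaps-word {N} lo n r z r≤ K≤N with gaps-blocks {N} lo n r (c ++ z) (≤-trans (s≤s (s≤s r≤)) K≤N)
        (≤-trans (m≤m+n 3 (length c)) K≤N)
    ... | r₁ , r₁≤1 , q₁ with gaps-short {N} r₁ c z (≤-trans (s≤s (+-monoˡ-≤ (length c) r₁≤1))
        (≤-trans (n≤1+n _) K≤N))
    ...   | r₂ , r₂≤ , q₂ = r₂ , ≤-trans r₂≤ (+-monoˡ-≤ (length c) r₁≤1) ,
            ≤-trans (≤-reflexive (cong (gaps N r) (++-assoc (blocks lo (suc n)) c z)))
                (≤-trans q₁ (≤-reflexive (cong suc q₂)))

    gaps-pow : ∀ {N} lo n → offset ≤ N → ∀ m r → r ≤ suc (length c) → gaps N r (pow (word lo (suc n)) m) ≤ m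
    gaps-pow lo n K≤N zero r r≤ = z≤n
    gaps-pow {N} lo n K≤N (suc m) r r≤ = step (gaps-word {N} lo n r (pow (word lo (suc n)) m) r≤ K≤N)
      where
      step : (∃ λ r′ → r′ ≤ suc (length c) × gaps N r (pow (word lo (suc n)) (suc m)) ≤ 1 + gaps N r′
          (pow (word lo (suc n)) m)) →
        gaps N r (pow (word lo (suc n)) (suc m)) ≤ suc m
      step (r′ , r′≤ , q) = ≤-trans q (s≤s (gaps-pow lo n K≤N m r′ r′≤))

    -- Two occurrences in `w` give four gaps in `w ++ w`, which lies in the cube of the word; but
    -- each of the three factors of the cube accounts for at most one gap.
    twice-rotation : ∀ {N w} lo n → offset ≤ N → Rot (word lo (suc n)) w → ¬ Twice N w
    twice-rotation {N} {w} lo n K≤N (α , β , q , refl) tw = <⇒≱ (s≤s (gaps-pow {N} lo n K≤N 3 0 z≤n)) (begin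
      4 ≤⟨ +-mono-≤ (twice-gaps {N} {suc N} tw) (twice-gaps {N} {suc N} tw) ⟩
      gaps N (suc N) w + gaps N (suc N) w ≤⟨ gaps-++ ≤-refl w w ⟩
      gaps N (suc N) (w ++ w) ≤⟨ m≤m+n _ _ ⟩
      gaps N (suc N) (w ++ w) + gaps N (suc N) β ≤⟨ gaps-++ ≤-refl (w ++ w) β ⟩
      gaps N (suc N) ((w ++ w) ++ β) ≤⟨ m≤n+m _ _ ⟩
      gaps N 0 α + gaps N (suc N) ((w ++ w) ++ β) ≤⟨ gaps-++ ≤-refl α _ ⟩
      gaps N 0 (α ++ (w ++ w) ++ β) ≡⟨ cong (gaps N 0) (trans (cong (λ z → pow z 3) q) (rotation-cube α β)) ⟨
      gaps N 0 (pow (word lo (suc n)) 3) ∎)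
      where open ≤-Reasoning

    -- Each Q can spoil at most one block, the one in which it ends.
    uncut-block : ∀ lo n Qs α β → α ++ blocks lo n ++ β ≡ concat Qs → length Qs < n →
      Any (λ Q → ∃ λ i → Marked (offset + i) Q) Qs
    uncut-block lo (suc n) [] α β q l = ⊥-elim (++-≢[]ʳ α {blocks lo (suc n) ++ β} (λ ()) q)
    uncut-block lo n (Q ∷ Qs) α β q l with ≤-total (length Q) (length α)
    uncut-block lo n (Q ∷ Qs) α β q l | inj₁ le with split-++ Q α (sym q) le
    ... | α₁ , refl , q₁ = there (uncut-block lo n Qs α₁ β (sym q₁) (<⇒≤ l))
    uncut-block lo (suc n) (Q ∷ Qs) α β q (s≤s l) | inj₂ le with split-++ α Q q le
    ... | Q₁ , refl , q₁ with ≤-total (length (first ∷ marker true (offset + (lo + n)))) (length Q₁)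
    ...   | inj₁ le′ with split-++ (first ∷ marker true (offset + (lo + n))) Q₁
        (trans (sym (reassoc lo n β)) q₁) le′
    ...     | ρ , refl , _ = here (lo + n , true , α ++ first ∷ [] , ρ , sym (++-assoc α (first ∷ []) _))
    uncut-block lo (suc n) (Q ∷ Qs) α β q (s≤s l) | inj₂ le | Q₁ , refl , q₁ | inj₂ le′
      with split-++ Q₁ (first ∷ marker true (offset + (lo + n))) (trans (sym q₁) (reassoc lo n β)) le′
    ...     | ρ , _ , q₂ = there (uncut-block lo n Qs (ρ ++ final ∷ []) β
        (trans (++-assoc ρ (final ∷ []) _) (sym q₂)) l)

    -- The square of a rotation contains the whole word. It is cut into at most `L + L` pieces,
    -- fewer than there are blocks, so some piece contains an entire marker, which would have to
    -- occur twice in the rotation.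
    simple-word : ∀ {L} lo n → L + L < suc n → Simple L (word lo (suc n))
    simple-word {L} lo n L<n {w} rot@(α , β , q , refl) (Ps , q₁ , l , tw) =
      contra (uncut-block lo (suc n) (Ps ++ Ps) β (c ++ α) q₂
          (≤-trans (s≤s (≤-trans (≤-reflexive (length-++ Ps)) (+-mono-≤ l l))) L<n)) (All.++⁺ tw tw)
      where
      q₂ : β ++ blocks lo (suc n) ++ c ++ α ≡ concat (Ps ++ Ps)
      q₂ = begin
        β ++ blocks lo (suc n) ++ c ++ α ≡⟨ cong (β ++_) (++-assoc (blocks lo (suc n)) c α) ⟨
        β ++ word lo (suc n) ++ α ≡⟨ cong (λ z → β ++ z ++ α) q ⟩
        β ++ (α ++ β) ++ α ≡⟨ cong (β ++_) (++-assoc α β α) ⟩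
        β ++ α ++ β ++ α ≡⟨ ++-assoc β α _ ⟨
        (β ++ α) ++ β ++ α ≡⟨ cong₂ _++_ q₁ q₁ ⟨
        concat Ps ++ concat Ps ≡⟨ concat-++ Ps Ps ⟩
        concat (Ps ++ Ps) ∎
        where open ≡-Reasoning
      contra : ∀ {Qs} → Any (λ Q → ∃ λ i → Marked (offset + i) Q) Qs → All
          (λ Q → ∀ N → Marked N Q → Twice N w) Qs → ⊥
      contra (here (i , m)) (t ∷ _) = twice-rotation lo n (m≤m+n offset i) rot (t (offset + i) m)
      contra (there a) (_ ∷ ts) = contra a ts

-- Invariance of definable sets under conjugation

-- Only up to `≈`: with `g = []` the same lemmas give invariance under `≈`, as in `at-cong`.
Conjugated : ∀ {v} → Word k → Assignment k v → Assignment k v → Set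
Conjugated g ρ ρ′ = ∀ i → ρ′ i ≈ g ++ ρ i ++ winv g

conj-conj : (g w : Word k) → w ≈ g ++ (winv g ++ w ++ g) ++ winv g
conj-conj g w = group-identity (g V.∷ w V.∷ V.[]) x₁ (x₀ · (((x₀ ⁻¹) · (x₁ · x₀)) · (x₀ ⁻¹))) refl

module _ {k : ℕ} (g : Word k) where

  eval-conj : ∀ {v} (ρ ρ′ : Assignment k v) → Conjugated g ρ ρ′ → (t : Term v) →
    eval ρ′ t ≈ g ++ eval ρ t ++ winv g
  eval-conj ρ ρ′ c (var i) = c i
  eval-conj ρ ρ′ c one = ≈-sym (winv-inverseʳ g)
  eval-conj ρ ρ′ c (t · s) = ≈-trans (++-cong-≈ (eval-conj ρ ρ′ c t) (eval-conj ρ ρ′ c s))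
    (group-identity (g V.∷ eval ρ t V.∷ eval ρ s V.∷ V.[])
      ((x₀ · (x₁ · (x₀ ⁻¹))) · (x₀ · (x₂ · (x₀ ⁻¹)))) (x₀ · ((x₁ · x₂) · (x₀ ⁻¹))) refl)
  eval-conj ρ ρ′ c (t ⁻¹) = ≈-trans (winv-cong-≈ (eval-conj ρ ρ′ c t))
    (group-identity (g V.∷ eval ρ t V.∷ V.[]) ((x₀ · (x₁ · (x₀ ⁻¹))) ⁻¹) (x₀ · ((x₁ ⁻¹) · (x₀ ⁻¹))) refl)

  conjugated-∷ : ∀ {v} {w w′ : Word k} {ρ ρ′ : Assignment k v} → w′ ≈ g ++ w ++ winv g → Conjugated g ρ ρ′ →
    Conjugated g (w V.∷ ρ) (w′ V.∷ ρ′)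
  conjugated-∷ e c zero = e
  conjugated-∷ e c (suc i) = c i

  -- Conjugation is an automorphism and carries along the values of quantified variables. The two
  -- directions are proved together because negation and implication exchange them.
  sat-conj : ∀ {v} (φ : Formula v) (ρ ρ′ : Assignment k v) → Conjugated g ρ ρ′ →
    (Sat k φ ρ → Sat k φ ρ′) × (Sat k φ ρ′ → Sat k φ ρ)
  sat-conj (t ≐ s) ρ ρ′ c =
    (λ e → un (≈-trans (eval-conj ρ ρ′ c t) (≈-trans (++-cong-≈ (≈-refl {u = g})
      (++-cong-≈ (eq {u = eval ρ t} {eval ρ s} e) (≈-refl {u = winv g}))) (≈-sym (eval-conj ρ ρ′ c s))))) ,
    (λ e → un (conj-cancel g {eval ρ t} {eval ρ s} (≈-trans (≈-sym (eval-conj ρ ρ′ c t))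
        (≈-trans (eq e) (eval-conj ρ ρ′ c s)))))
  sat-conj tt ρ ρ′ c = id , id
  sat-conj ff ρ ρ′ c = id , id
  sat-conj (¬' φ) ρ ρ′ c = let f , f⁻ = sat-conj φ ρ ρ′ c in (_∘ f⁻) , (_∘ f)
  sat-conj (φ ∧' ψ) ρ ρ′ c =
    let f , f⁻ = sat-conj φ ρ ρ′ c
        h , h⁻ = sat-conj ψ ρ ρ′ c
    in (λ { (a , b) → f a , h b }) , (λ { (a , b) → f⁻ a , h⁻ b })
  sat-conj (φ ∨' ψ) ρ ρ′ c =
    let f , f⁻ = sat-conj φ ρ ρ′ c
        h , h⁻ = sat-conj ψ ρ ρ′ c
    in (λ { n (a , b) → n (a ∘ f , b ∘ h) }) , (λ { n (a , b) → n (a ∘ f⁻ , b ∘ h⁻) })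
  sat-conj (φ ⇒' ψ) ρ ρ′ c =
    let f , f⁻ = sat-conj φ ρ ρ′ c
        h , h⁻ = sat-conj ψ ρ ρ′ c
    in (λ i → h ∘ i ∘ f⁻) , (λ i → h⁻ ∘ i ∘ f)
  sat-conj (∀' φ) ρ ρ′ c =
    (λ f w → proj₁ (sat-conj φ ((winv g ++ w ++ g) V.∷ ρ) (w V.∷ ρ′) (conjugated-∷ (conj-conj g w) c))
        (f (winv g ++ w ++ g))) ,
    (λ f w → proj₂ (sat-conj φ (w V.∷ ρ) ((g ++ w ++ winv g) V.∷ ρ′) (conjugated-∷ ≈-refl c))
        (f (g ++ w ++ winv g)))
  sat-conj (∃' φ) ρ ρ′ c =
    (λ n f → n λ w s → f (g ++ w ++ winv g) (proj₁ (sat-conj φ (w V.∷ ρ) ((g ++ w ++ winv g) V.∷ ρ′)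
        (conjugated-∷ ≈-refl c)) s)) ,
    (λ n f → n λ w s → f (winv g ++ w ++ g) (proj₂ (sat-conj φ ((winv g ++ w ++ g) V.∷ ρ) (w V.∷ ρ′)
        (conjugated-∷ (conj-conj g w) c)) s))

-- Ramsey's theorem and unions of equational sets

-- Truth of formulas is not assumed decidable; finitely many double negations can be removed
-- together when the goal is itself negated.
¬¬-All : {A : Set} {P : A → Set} {xs : List A} → All (λ x → ¬ ¬ P x) xs → ¬ ¬ All P xs
¬¬-All [] κ = κ []
¬¬-All (p ∷ ps) κ = p λ q → ¬¬-All ps λ qs → κ (q ∷ qs)

¬¬-AllPairs : {A : Set} {R : A → A → Set} {xs : List A} → AllPairs (λ x y → ¬ ¬ R x y) xs → ¬ ¬ AllPairs R xs
¬¬-AllPairs [] κ = κ []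
¬¬-AllPairs (p ∷ ps) κ = ¬¬-All p λ q → ¬¬-AllPairs ps λ qs → κ (q ∷ qs)

allPairs-lookup : {A : Set} {R : A → A → Set} {xs : List A} → AllPairs R xs → {i j : Fin (length xs)} →
  toℕ i < toℕ j → R (lookup xs i) (lookup xs j)
allPairs-lookup (p ∷ ps) {zero} {suc j} l = All.lookup p (∈-lookup j)
allPairs-lookup (p ∷ ps) {suc i} {suc j} (s≤s l) = allPairs-lookup ps l

AllPairs-resp-⊆ : {A : Set} {R : A → A → Set} {xs ys : List A} → xs ⊆ ys → AllPairs R ys → AllPairs R xs
AllPairs-resp-⊆ [] [] = []
AllPairs-resp-⊆ (y ∷ʳ τ) (p ∷ ps) = AllPairs-resp-⊆ τ ps
AllPairs-resp-⊆ (refl ∷ τ) (p ∷ ps) = All-resp-⊆ τ p ∷ AllPairs-resp-⊆ τ ps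

All-split : {A : Set} {P Q : A → Set} {xs : List A} → All (λ y → P y ⊎ Q y) xs →
  ∃₂ λ ys zs → ys ⊆ xs × zs ⊆ xs × length ys + length zs ≡ length xs × All P ys × All Q zs
All-split [] = [] , [] , [] , [] , refl , [] , []
All-split {xs = x ∷ _} (inj₁ p ∷ ps) with All-split ps
... | ys , zs , τ , υ , l , a , b = x ∷ ys , zs , refl ∷ τ , x ∷ʳ υ , cong suc l , p ∷ a , b
All-split {xs = x ∷ _} (inj₂ q ∷ ps) with All-split ps
... | ys , zs , τ , υ , l , a , b = ys , x ∷ zs , x ∷ʳ τ , refl ∷ υ , trans (+-suc (length ys) _)
    (cong suc l) , a , q ∷ b

module _ {A : Set} (R S : A → A → Set) where

  -- The usual recurrence: the elements after the first are divided according to their relation to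
  -- it, and one of the two classes is large enough for the induction.
  ramsey : ∀ m n → ∃ λ N → ∀ xs → N ≤ length xs → AllPairs (λ x y → R x y ⊎ S x y) xs →
    (∃ λ ys → ys ⊆ xs × m ≤ length ys × AllPairs R ys) ⊎ (∃ λ zs → zs ⊆ xs × n ≤ length zs × AllPairs S zs)
  ramsey zero n = 0 , λ xs _ _ → inj₁ ([] , minimum xs , z≤n , [])
  ramsey (suc m) zero = 0 , λ xs _ _ → inj₂ ([] , minimum xs , z≤n , [])
  ramsey (suc m) (suc n) with ramsey m (suc n) | ramsey (suc m) n
  ... | N₁ , f | N₂ , g = suc (N₁ + N₂) , step
    where
    step : ∀ xs → suc (N₁ + N₂) ≤ length xs → AllPairs (λ x y → R x y ⊎ S x y) xs →
      (∃ λ ys → ys ⊆ xs × suc m ≤ length ys × AllPairs R ys) ⊎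
          (∃ λ zs → zs ⊆ xs × suc n ≤ length zs × AllPairs S zs)
    step (x ∷ xs) (s≤s l) (c ∷ cs) with All-split c
    ... | ys , zs , τ , υ , e , a , b with ≤-total N₁ (length ys)
    ...   | inj₁ N₁≤ with f ys N₁≤ (AllPairs-resp-⊆ τ cs)
    ...     | inj₁ (ws , ω , lw , pw) = inj₁ (x ∷ ws , refl ∷ ⊆-trans ω τ , s≤s lw , All-resp-⊆ ω a ∷ pw)
    ...     | inj₂ (ws , ω , lw , pw) = inj₂ (ws , x ∷ʳ ⊆-trans ω τ , lw , pw)
    step (x ∷ xs) (s≤s l) (c ∷ cs) | ys , zs , τ , υ , e , a , b | inj₂ ≤N₁
      with g zs (+-cancelˡ-≤ N₁ _ _ (≤-trans l (≤-trans (≤-reflexive (sym e)) (+-monoˡ-≤ (length zs) ≤N₁))))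
          (AllPairs-resp-⊆ υ cs)
    ...     | inj₁ (ws , ω , lw , pw) = inj₁ (ws , x ∷ʳ ⊆-trans ω υ , lw , pw)
    ...     | inj₂ (ws , ω , lw , pw) = inj₂ (x ∷ ws , refl ∷ ⊆-trans ω υ , s≤s lw , All-resp-⊆ ω b ∷ pw)

-- The relation Q (a b) between a and b is equational with bound N.
Noetherian : (Word k → Set) → ℕ → Set
Noetherian {k} Q N = (xs : List (Word k × Word k)) → N < length xs →
  AllPairs (λ x y → Q (proj₁ y ++ proj₂ x)) xs → ¬ All (λ x → ¬ Q (proj₁ x ++ proj₂ x)) xs

-- Each pair is coloured by one of the two sets that contains its product. A long one-coloured
-- sublist contradicts the bound for its set, as the condition on the diagonal passes to sublists.
noetherian-⊎ : {Q₁ Q₂ : Word k → Set} {N₁ N₂ : ℕ} → Noetherian Q₁ N₁ → Noetherian Q₂ N₂ →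
  ∃ λ N → Noetherian (λ γ → Q₁ γ ⊎ Q₂ γ) N
noetherian-⊎ {Q₁ = Q₁} {Q₂} {N₁} {N₂} n₁ n₂
  with ramsey (λ x y → Q₁ (proj₁ y ++ proj₂ x)) (λ x y → Q₂ (proj₁ y ++ proj₂ x)) (suc N₁) (suc N₂)
... | N , f = N , λ xs l c d → contra (f xs (<⇒≤ l) c) d
  where
  contra : ∀ {xs} → _ → All (λ x → ¬ (Q₁ (proj₁ x ++ proj₂ x) ⊎ Q₂ (proj₁ x ++ proj₂ x))) xs → ⊥
  contra (inj₁ (ys , τ , l , c)) d = n₁ ys l c (All-resp-⊆ τ (All.map (_∘ inj₁) d))
  contra (inj₂ (zs , τ , l , c)) d = n₂ zs l c (All-resp-⊆ τ (All.map (_∘ inj₂) d))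

infix 3 _~_
-- Equality of classical truth values, in a form that the Boolean operations preserve without any
-- decision.
_~_ : Set → Set → Set
A ~ B = (¬ A → ¬ B) × (¬ B → ¬ A)

~-refl : {A : Set} → A ~ A
~-refl = id , id

module _ {k n m : ℕ} where

  Equations : Set
  Equations = List (Σ (Formula (n + m)) λ ψ → Equational {k} {n} {m} ⟦ ψ ⟧)

  equations : {P : Rel k n m} → InBA P → Equations
  equations (gen ψ e) = (ψ , e) ∷ []
  equations top = []
  equations (compl a) = equations a
  equations (inter a b) = equations a ++ equations b
  equations (union a b) = equations a ++ equations b

  indistinguishable : ∀ {p q p′ q′} {P : Rel k n m} (a : InBA P) →
    All (λ ψ → ⟦ proj₁ ψ ⟧ p q ~ ⟦ proj₁ ψ ⟧ p′ q′) (equations a) → P p q ~ P p′ q′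
  indistinguishable (gen ψ e) (h ∷ []) = h
  indistinguishable top _ = ~-refl
  indistinguishable (compl a) h =
    let f , g = indistinguishable a h in (λ x y → x (g y)) , (λ x y → x (f y))
  indistinguishable (inter a b) h =
    let f , g = indistinguishable a (All.++⁻ˡ (equations a) h)
        f′ , g′ = indistinguishable b (All.++⁻ʳ (equations a) h)
    in (λ { n (x , y) → f (λ u → f′ (λ w → n (u , w)) y) x }) ,
        (λ { n (x , y) → g (λ u → g′ (λ w → n (u , w)) y) x })
  indistinguishable (union a b) h =
    let f , g = indistinguishable a (All.++⁻ˡ (equations a) h)
        f′ , g′ = indistinguishable b (All.++⁻ʳ (equations a) h)
    in (λ n x → n λ { (y , z) → x (f y , f′ z) }) , (λ n x → n λ { (y , z) → x (g y , g′ z) })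

-- Equational sets on pairs of conjugates of a basis pair

module _ {j : ℕ} where

  basis : Assignment (2 + j) 2
  basis zero = (zero , true) ∷ []
  basis (suc zero) = (suc zero , true) ∷ []

  conjBasis : Word (2 + j) → Assignment (2 + j) 2
  conjBasis g i = g ++ basis i ++ winv g

  -- The pair with conjugators `[]` and `γ` represents all pairs with conjugators `g` and `h` such
  -- that `winv g ++ h ≈ γ`.
  At : Formula 4 → Word (2 + j) → Set
  At ψ γ = ⟦_⟧ {2 + j} {2} {2} ψ basis (conjBasis γ)

  at-conj : ∀ ψ a b → (⟦_⟧ {2 + j} {2} {2} ψ (conjBasis (winv a)) (conjBasis b) → At ψ (a ++ b)) ×
    (At ψ (a ++ b) → ⟦_⟧ {2 + j} {2} {2} ψ (conjBasis (winv a)) (conjBasis b))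
  at-conj ψ a b = swap (sat-conj (winv a) ψ (basis V.++ conjBasis (a ++ b))
      (conjBasis (winv a) V.++ conjBasis b) c)
    where
    lemma : ∀ i → b ++ basis i ++ winv b ≈ winv a ++ ((a ++ b) ++ basis i ++ winv (a ++ b)) ++ winv (winv a)
    lemma i = group-identity (a V.∷ b V.∷ basis i V.∷ V.[]) (x₁ · (x₂ · (x₁ ⁻¹)))
      ((x₀ ⁻¹) · (((x₀ · x₁) · (x₂ · ((x₀ · x₁) ⁻¹))) · ((x₀ ⁻¹) ⁻¹))) refl
    c : Conjugated (winv a) (basis V.++ conjBasis (a ++ b)) (conjBasis (winv a) V.++ conjBasis b)
    c zero = ≈-refl
    c (suc zero) = ≈-refl
    c (suc (suc zero)) = lemma zero
    c (suc (suc (suc zero))) = lemma (suc zero)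

  at-cong : ∀ ψ {γ γ′} → γ ≈ γ′ → At ψ γ → At ψ γ′
  at-cong ψ {γ} {γ′} e = proj₁ (sat-conj [] ψ (basis V.++ conjBasis γ) (basis V.++ conjBasis γ′) c)
    where
    lemma : ∀ i → γ′ ++ basis i ++ winv γ′ ≈ (γ ++ basis i ++ winv γ) ++ []
    lemma i = ≈-trans (++-cong-≈ (≈-sym e) (++-cong-≈ (≈-refl {u = basis i}) (winv-cong-≈ (≈-sym e))))
      (≡⇒≈ (sym (++-identityʳ _)))
    c : Conjugated [] (basis V.++ conjBasis γ) (basis V.++ conjBasis γ′)
    c zero = ≈-refl
    c (suc zero) = ≈-refl
    c (suc (suc zero)) = lemma zero
    c (suc (suc (suc zero))) = lemma (suc zero)

  -- The elements `b` give the parameters. For each pair of the list, the point with conjugator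
  -- `winv a` lies in the sets of all earlier parameters but not in that of its own, so the
  -- intersections strictly decrease.
  equational-noetherian : ∀ ψ → ((N , _) : Equational {2 + j} {2} {2} ⟦ ψ ⟧) → Noetherian (At ψ) N
  equational-noetherian ψ (N , bound) xs l c d = <⇒≱ l (bound (length xs)
      (λ i → conjBasis (proj₂ (lookup xs i))) decreasing)
    where
    decreasing : StrictlyDecreasing {2 + j} {2} {2} ⟦ ψ ⟧ (length xs) (λ i → conjBasis (proj₂ (lookup xs i)))
    decreasing i _ i<l f = All.lookup d (∈-lookup i′) (proj₁ (at-conj ψ a (proj₂ (lookup xs i′)))
      (f (conjBasis (winv a)) (λ i″ i″<i → proj₂ (at-conj ψ a (proj₂ (lookup xs i″)))
           (allPairs-lookup c {i″} {i′} (≤-trans i″<i (≤-reflexive (sym (toℕ-fromℕ< i<l))))))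
         i′ (s≤s (≤-reflexive (toℕ-fromℕ< i<l)))))
      where
      i′ : Fin (length xs)
      i′ = fromℕ< i<l
      a : Word (2 + j)
      a = proj₁ (lookup xs i′)

  Eqs : Set
  Eqs = Equations {2 + j} {2} {2}

  Some : Eqs → Word (2 + j) → Set
  Some [] γ = ⊥
  Some ((ψ , _) ∷ ψs) γ = At ψ γ ⊎ Some ψs γ

  some-cong : ∀ ψs {γ γ′} → γ ≈ γ′ → Some ψs γ → Some ψs γ′
  some-cong ((ψ , _) ∷ ψs) e (inj₁ x) = inj₁ (at-cong ψ e x)
  some-cong (_ ∷ ψs) e (inj₂ x) = inj₂ (some-cong ψs e x)

  some-noetherian : ∀ ψs → ∃ λ N → Noetherian (Some ψs) N
  -- The bound cannot be 0: a list with one element satisfies the condition on pairs vacuously.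
  some-noetherian [] = 1 , λ { (x ∷ y ∷ xs) _ ((() ∷ _) ∷ _) ; (x ∷ []) (s≤s ()) }
  some-noetherian ((ψ , e) ∷ ψs) = noetherian-⊎ {Q₁ = At ψ} {Some ψs} (equational-noetherian ψ e)
      (proj₂ (some-noetherian ψs))

  -- If `w` does not end with the inverse of `a`, both products are reduced and begin with different
  -- generators; if it does, one product becomes shorter than `w` and the other longer.
  letter-centralizer : ∀ {w} → Red w → (a b : Letter (2 + j)) → proj₁ b ≢ proj₁ a → head w ≡ just b →
    ¬ (w ++ a ∷ [] ≈ a ∷ w)
  letter-centralizer {w@(b ∷ w′)} r a .b b≢a refl e with unsnoc b w′
  ... | w₂ , d , q with d ≟L invL a
  ...   | no d≢ = b≢a (cong proj₁ (∷-injectiveˡ (red-unique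
            (red-++ r [-] λ { p refl → λ z → d≢ (trans (just-injective
                (trans (sym (last-∷ʳ w₂ d)) (trans (cong last (sym q)) p))) z) })
            ((λ z → b≢a (sym (cong proj₁ z))) ∷ r) e)))
  ...   | yes refl = <⇒≢ (≤-trans (s≤s (≤-trans (m≤m+n (length w₂) 1)
      (≤-reflexive (trans (sym (length-++ w₂)) (cong length (sym q)))))) ≤-refl)
            (cong length (red-unique (red-++⁻ˡ w₂ (subst Red q r)) ((λ z → b≢a (sym (cong proj₁ z))) ∷ r)
              (≈-trans (≈-trans (group-identity (w₂ V.∷ (a ∷ []) V.∷ V.[]) x₀ ((x₀ · (x₁ ⁻¹)) · x₁) refl)
                  (≡⇒≈ (cong (_++ a ∷ []) (sym q)))) e)))

  basis-centralizer : ∀ w → (∀ i → w ++ basis i ≈ basis i ++ w) → w ≈ []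
  basis-centralizer w h = ≈-trans (≈-sym (reduce-≈ w)) (≡⇒≈ (empty (reduce w) (red-reduce w)
    (λ i → ≈-trans (++-cong-≈ (reduce-≈ w) ≈-refl) (≈-trans (h i)
        (++-cong-≈ (≈-refl {u = basis i}) (≈-sym (reduce-≈ w)))))))
    where
    empty : ∀ w → Red w → (∀ i → w ++ basis i ≈ basis i ++ w) → w ≡ []
    empty [] r h = refl
    empty ((zero , b) ∷ w) r h = ⊥-elim (letter-centralizer r (suc zero , true) (zero , b) (λ ()) refl
        (h (suc zero)))
    empty ((suc i , b) ∷ w) r h = ⊥-elim (letter-centralizer r (zero , true) (suc i , b) (λ ()) refl (h zero))

  -- Only the identity commutes with two basis elements, so the conjugator is determined by the
  -- conjugated pair. This lets a formula about pairs speak of `γ` itself.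
  conjBasis-injective : ∀ z γ → (∀ i → z ++ basis i ++ winv z ≈ γ ++ basis i ++ winv γ) → z ≈ γ
  conjBasis-injective z γ h = ≈-trans (group-identity (z V.∷ γ V.∷ V.[]) x₀ (x₁ · ((x₁ ⁻¹) · x₀)) refl)
    (≈-trans (++-cong-≈ (≈-refl {u = γ}) (basis-centralizer (winv γ ++ z) commute)) (≡⇒≈ (++-identityʳ γ)))
    where
    commute : ∀ i → (winv γ ++ z) ++ basis i ≈ basis i ++ winv γ ++ z
    commute i = ≈-trans (group-identity (z V.∷ γ V.∷ basis i V.∷ V.[]) (((x₁ ⁻¹) · x₀) · x₂)
        ((x₁ ⁻¹) · ((x₀ · (x₂ · (x₀ ⁻¹))) · x₀)) refl)
      (≈-trans (++-cong-≈ (≈-refl {u = winv γ}) (++-cong-≈ (h i) (≈-refl {u = z})))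
      (group-identity (z V.∷ γ V.∷ basis i V.∷ V.[]) ((x₁ ⁻¹) · ((x₁ · (x₂ · (x₁ ⁻¹))) · x₀))
          (x₂ · ((x₁ ⁻¹) · x₀)) refl))

-- The definable set of products of powers

_^ᵗ_ : ∀ {v} → Term v → ℕ → Term v
t ^ᵗ zero = one
t ^ᵗ suc n = t · (t ^ᵗ n)

eval-^ᵗ : ∀ {v} (ρ : Assignment k v) t n → eval ρ (t ^ᵗ n) ≡ pow (eval ρ t) n
eval-^ᵗ ρ t zero = refl
eval-^ᵗ ρ t (suc n) = cong (eval ρ t ++_) (eval-^ᵗ ρ t n)

-- Under the outer quantifier, p = (x₁ , x₂) and q = (x₃ , x₄); under all three, v = x₀, u = x₁, z = x₂.
formula : ℕ → Formula 4
formula n = ∃' ((((x₀ · (x₁ · (x₀ ⁻¹))) ≐ x₃) ∧' ((x₀ · (x₂ · (x₀ ⁻¹))) ≐ x₄)) ∧'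
  (∃' (∃' ((x₂ ≐ ((x₁ ^ᵗ suc n) · ((x₀ ^ᵗ n) ⁻¹))) ∧' (¬' ((x₁ · x₀) ≐ (x₀ · x₁)))))))

module _ {j : ℕ} (n : ℕ) where

  Product : Word (2 + j) → Set
  Product γ = ∃₂ λ u v → γ ≈ pow u (suc n) ++ winv (pow v n) × ¬ (u ++ v ≈ v ++ u)

  private
    env : (γ z u v : Word (2 + j)) → Assignment (2 + j) 7
    env γ z u v = v V.∷ u V.∷ z V.∷ (basis V.++ conjBasis γ)

    eval-powers : ∀ γ z u v → eval (env γ z u v) ((x₁ ^ᵗ suc n) · ((x₀ ^ᵗ n) ⁻¹)) ≡ pow u (suc n) ++ winv
        (pow v n)
    eval-powers γ z u v = cong₂ (λ x y → x ++ winv y) (eval-^ᵗ (env γ z u v) x₁ (suc n))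
        (eval-^ᵗ (env γ z u v) x₀ n)

  product⇒formula : ∀ {γ} → Product γ → At (formula n) γ
  product⇒formula {γ} (u , v , e , nc) κ = κ γ ((refl , refl) , λ κ′ → κ′ u λ κ″ → κ″ v
    (un (≈-trans e (≡⇒≈ (sym (eval-powers γ γ u v)))) , nc ∘ eq))

  formula⇒product : ∀ {γ} → At (formula n) γ → ¬ ¬ Product γ
  formula⇒product {γ} h κ = h λ { z ((e₁ , e₂) , h′) → h′ λ u h″ → h″ λ { v (e , nc) →
    κ (u , v , ≈-trans (≈-sym (conjBasis-injective z γ λ { zero → eq e₁ ; (suc zero) → eq e₂ }))
      (≈-trans (eq {u = z} e) (≡⇒≈ (eval-powers γ z u v))) , nc ∘ un) } }

  module _ (14≤n : 14 ≤ n) where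

    -- The number of pieces for exponents `suc n` and `n`: all periods, and two end pieces for each
    -- power.
    maxPieces : ℕ
    maxPieces = 4 + (suc n + n)

    module _ (c : Word (2 + j)) (rc : Red c) where

      word-not-product : ∀ lo i → maxPieces + maxPieces ≤ i → ¬ At (formula n) (word c rc lo (suc i))
      word-not-product lo i l h = formula⇒product h λ { (u , v , e , nc) →
        power-product-commutes Marked (λ {N} → marked-infix {N = N}) (λ {N} → marked-winv {N = N})
          (cyc-word c rc lo i) (λ ()) (simple-word c rc lo i (s≤s l)) (m≤n⇒m≤1+n 14≤n) 14≤n ≤-refl u v e nc }

    -- The case in which membership in the set defined by `formula n` is constant outside the union
    -- of the `ψs`, while some `c` lies outside that union.
    module Density (ψs : Eqs {j}) (same : ∀ γ γ′ → ¬ Some ψs γ → ¬ Some ψs γ′ → At (formula n) γ ~ At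
        (formula n) γ′)
      (c : Word (2 + j)) (rc : Red c) (c∉ : ¬ Some ψs c) where

      N : ℕ
      N = proj₁ (some-noetherian ψs)

      M : ℕ
      M = suc (maxPieces + maxPieces)

      -- An element outside the union with enough blocks to be no product of powers as well. Its
      -- first marker is given by `hi`, so elements with different `hi` do not commute.
      record Point : Set where
        constructor point
        field
          lo i : ℕ
          long : maxPieces + maxPieces ≤ i
          outside : ¬ Some ψs (word c rc lo (suc i))

        hi : ℕ
        hi = lo + i

        elem : Word (2 + j)
        elem = word c rc lo (suc i)
      open Point

      no-pairs : ∀ xs → N < length xs → All (λ x → ¬ Some ψs (proj₁ x ++ proj₂ x)) xs →
        ¬ AllPairs (λ x y → ¬ ¬ Some ψs (proj₁ y ++ proj₂ x)) xs
      no-pairs xs l d c = ¬¬-AllPairs c λ c′ → proj₂ (some-noetherian ψs) xs l c′ d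

      -- The products on the diagonal are all equal to `c`, so some product off the diagonal is
      -- outside the union. Starting the blocks at `lo₀` makes its first marker as long as desired.
      points-above : ∀ lo₀ → ¬ ¬ ∃ λ (t : Point) → lo₀ ≤ hi t
      points-above lo₀ κ = no-pairs (applyUpTo pair (suc N)) (≤-reflexive (sym (length-applyUpTo pair (suc N))))
        (All.applyUpTo⁺₂ pair (suc N) diagonal)
        (AllPairs.applyUpTo⁺₁ pair (suc N) λ {i} {i′} i<i′ _ → off i i′ i<i′)
        where
        A : ℕ → Word (2 + j)
        A i = blocks c rc lo₀ (i * M)
        pair : ℕ → Word (2 + j) × Word (2 + j)
        pair i = A i , winv (A i) ++ c
        diagonal : ∀ i → ¬ Some ψs (A i ++ winv (A i) ++ c)
        diagonal i h = c∉ (some-cong ψs (group-identity (A i V.∷ c V.∷ V.[]) (x₀ · ((x₀ ⁻¹) · x₁)) x₁ refl) h)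
        off : ∀ i i′ → i < i′ → ¬ ¬ Some ψs (A i′ ++ winv (A i) ++ c)
        off i i′ i<i′ h with m≤n⇒∃[o]m+o≡n i<i′
        -- The later index is `suc i + d`, and the quotient has `suc d * M` blocks. The successor in
        -- `M` supplies the `suc` in the length of a `Point`.
        ... | d , refl = κ (point (lo₀ + i * M) (maxPieces + maxPieces + d * M)
            (m≤m+n (maxPieces + maxPieces) (d * M))
                (λ h′ → h (some-cong ψs (≈-sym value) h′)) ,
                ≤-trans (m≤m+n lo₀ (i * M)) (m≤m+n (lo₀ + i * M) _))
          where
          B : Word (2 + j)
          B = blocks c rc (lo₀ + i * M) (suc d * M)
          split : A (suc i + d) ≡ B ++ A i
          split = trans (cong (blocks c rc lo₀) (trans (cong (λ z → suc z * M) (+-comm i d))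
              (*-distribʳ-+ M (suc d) i)))
            (blocks-++ c rc lo₀ (suc d * M) (i * M))
          value : A (suc i + d) ++ winv (A i) ++ c ≈ B ++ c
          value = ≈-trans (≡⇒≈ (cong (_++ winv (A i) ++ c) split))
            (group-identity (B V.∷ A i V.∷ c V.∷ V.[]) ((x₀ · x₁) · ((x₁ ⁻¹) · x₂)) (x₀ · x₂) refl)

      chain : ∀ l lo₀ → ¬ ¬ ∃ λ ts → length ts ≡ l × All (λ t → lo₀ ≤ hi t) ts × AllPairs
          (λ t t′ → hi t < hi t′) ts
      chain zero lo₀ κ = κ ([] , refl , [] , [])
      chain (suc l) lo₀ κ = points-above lo₀ λ { (t , t≥) → chain l (suc (hi t)) λ { (ts , e , a , p) →
        κ (t ∷ ts , cong suc e , t≥ ∷ All.map (λ h → ≤-trans t≥ (<⇒≤ h)) a , a ∷ p) } }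

      contradiction : ⊥
      contradiction = chain (suc N) 0 λ { (ts , e , _ , p) →
        no-pairs (map pair ts) (≤-reflexive (sym (trans (length-map pair ts) e)))
          (All.map⁺ (All.universal diagonal ts)) (AllPairs.map⁺ (AllPairs.map (λ {t} {t′} → off t t′) p)) }
        where
        pair : Point → Word (2 + j) × Word (2 + j)
        pair t = pow (elem t) (suc n) , winv (pow (elem t) n)
        diagonal : ∀ t → ¬ Some ψs (pow (elem t) (suc n) ++ winv (pow (elem t) n))
        diagonal t h = outside t (some-cong ψs (group-identity (elem t V.∷ pow (elem t) n V.∷ V.[])
            ((x₀ · x₁) · (x₁ ⁻¹)) x₀ refl) h)
        -- Outside the union this product would share the status of `elem t`, which is no product of
        -- powers of noncommuting elements; but it is one, since different `hi` exclude commutation.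
        off : ∀ t t′ → hi t < hi t′ → ¬ ¬ Some ψs (pow (elem t′) (suc n) ++ winv (pow (elem t) n))
        off t t′ l h = proj₁ (same (elem t) _ (outside t) h) (word-not-product c rc (lo t) (i t) (long t))
          (product⇒formula (elem t′ , elem t , ≈-refl , λ z → <⇒≢ l
              (sym (word-commute c rc (lo t′) (i t′) (lo t) (i t) z))))

    not-boolean : (φs ψs : Eqs {j}) → (∀ γ γ′ → ¬ Some ψs γ → ¬ Some ψs γ′ →
      All (λ ψ → At (proj₁ ψ) γ ~ At (proj₁ ψ) γ′) φs → At (formula n) γ ~ At (formula n) γ′) →
      ∀ c → ¬ ¬ Some ψs c
    not-boolean [] ψs same c c∉ = Density.contradiction ψs (λ γ γ′ h h′ → same γ γ′ h h′ [])
      (reduce c) (red-reduce c) (c∉ ∘ some-cong ψs (reduce-≈ c))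
    not-boolean (φ ∷ φs) ψs same c c∉ = not-boolean φs ψs
      (λ γ γ′ h h′ a → same γ γ′ h h′ (((λ z → ⊥-elim (holds γ h z)) ,
          (λ z → ⊥-elim (holds γ′ h′ z))) ∷ a)) c c∉
      where
      holds : ∀ γ → ¬ Some ψs γ → ¬ ¬ At (proj₁ φ) γ
      holds γ h h′ = not-boolean φs (φ ∷ ψs)
        -- Outside the enlarged union `φ` fails for both elements, so they agree on it.
        (λ γ γ′ g g′ a → same γ γ′ (g ∘ inj₂) (g′ ∘ inj₂) (((λ _ → g′ ∘ inj₁) , (λ _ → g ∘ inj₁)) ∷ a))
        γ [ h′ , h ]′

theorem1 : (k : ℕ) → 2 ≤ k →
    Σ ℕ λ n → Σ ℕ λ m → Σ (Formula (n + m)) λ φ →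
    ¬ (Σ (Rel k n m) λ P → InBA P ×
    ((p : Assignment k n) (q : Assignment k m) →
    (⟦ φ ⟧ p q → P p q) × (P p q → ⟦ φ ⟧ p q)))
-- 14 is the least exponent that the length estimates admit. The induction starts from the empty
-- union, to which no element belongs.
theorem1 (suc (suc j)) (s≤s (s≤s _)) = 2 , 2 , formula 14 , λ { (P , a , h) →
  not-boolean 14 ≤-refl (equations a) [] (λ γ γ′ _ _ s →
    let f , g = indistinguishable a s
        i , o = h basis (conjBasis γ)
        i′ , o′ = h basis (conjBasis γ′)
    in (λ n x → f (n ∘ o) (i′ x)) , (λ n x → g (n ∘ o′) (i x))) [] id }
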